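{- Let $n\geq 1$. The number of configurations of the twenty-vertex model with DWBC1 on the $n\times n$ grid and the number of configurations of the twenty-vertex model with DWBC2 on the $n\times n$ grid are both equal to $$Z^{6V}_{[1,\sqrt2,1]}(n)=\sum_{C}(\sqrt{2})^{\,b(C)},$$ where $C$ runs over all six-vertex configurations with domain wall boundary conditions on the $n\times n$ grid and $b(C)$ is the number of vertices of type $b$ in $C$.
   Context: Twenty-vertex (20V) model. Fix $n\ge 1$ and vertices $(x,y)\in\{1,\dots,n\}^2$. Inner edges: horizontal $\{(x,y),(x+1,y)\}$ ($x<n$), vertical $\{(x,y),(x,y+1)\}$ ($y<n$), diagonal $\{(x,y+1),(x+1,y)\}$ ($x,y<n$). Boundary edges with prescribed orientations: West: from $(0,y)$ to $(1,y)$ ($1\le y\le n$) and from $(0,y+1)$ to $(1,y)$ ($1\le y\le n-1$); South: from $(x,1)$ to $(x,0)$ ($1\le x\le n$) and from $(x,1)$ to $(x+1,0)$ ($1\le x\le n-1$); East: from $(n+1,y)$ to $(n,y)$ ($1\le y\le n$) and from $(n+1,y)$ to $(n,y+1)$ ($1\le y\le n-1$); North: from $(x,n)$ to $(x,n+1)$ ($1\le x\le n$) and from $(x+1,n)$ to $(x,n+1)$ ($1\le x\le n-1$). Two further corner diagonal edges: for DWBC1 they are oriented from $(0,n+1)$ to $(1,n)$ and from $(n,1)$ to $(n+1,0)$; for DWBC2 they are oriented from $(1,n)$ to $(0,n+1)$ and from $(n+1,0)$ to $(n,1)$. Every vertex then has exactly six incident edges. A configuration (with DWBC1, resp. DWBC2)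 is an orientation of all inner edges such that at every vertex exactly three incident edges point towards it and three point away from it. Six-vertex (6V) model with domain wall boundary conditions (DWBC). Vertices $(x,y)\in\{1,\dots,n\}^2$, inner edges the horizontal and vertical edges between neighbouring vertices, and boundary edges oriented from $(0,y)$ to $(1,y)$ (West), from $(n+1,y)$ to $(n,y)$ (East), from $(x,1)$ to $(x,0)$ (South), from $(x,n)$ to $(x,n+1)$ (North). A configuration is an orientation of the inner edges such that every vertex has exactly two incoming and two outgoing incident edges. Call an edge occupied if it is horizontal and oriented West-to-East or vertical and oriented North-to-South. A vertex is of type $a$ if all four or none of its incident edges are occupied, of type $b$ if exactly its two horizontal or exactly its two vertical edges are occupied, and of type $c$ otherwise (exactly its West and South edges, or exactly its North and East edges, are occupied). -}

module Defs where

open import Data.Nat using (ℕ; zero; suc; _+_; _*_; _∸_; _≡ᵇ_)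
open import Data.Bool using (Bool; true; false; if_then_else_; not; _∧_; _∨_)
open import Data.Fin using (Fin; zero; suc)
open import Data.List using (List; []; _∷_; map; concatMap; upTo; length; filterᵇ; foldr)
open import Data.Product using (_×_; _,_)
open import Function using (_∘_)

allFuns : {A : Set} → (k : ℕ) → List A → List (Fin k → A)
allFuns zero    xs = (λ ()) ∷ []
allFuns (suc k) xs =
  concatMap (λ a → map (λ f → λ { zero → a ; (suc i) → f i }) (allFuns k xs)) xs

bools : List Bool
bools = true ∷ false ∷ []

allArrays : (a b : ℕ) → List (Fin a → Fin b → Bool)
allArrays a b = allFuns a (allFuns b bools)

at : {A : Set} {k : ℕ} → (Fin k → A) → ℕ → A → A
at {k = zero}  f i       d = d
at {k = suc k} f zero    d = f zero
at {k = suc k} f (suc i) d = at (f ∘ suc) i d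

at2 : {a b : ℕ} → (Fin a → Fin b → Bool) → ℕ → ℕ → Bool
at2 f i j = at (λ r → at (f r) j false) i false

allᵇ : {A : Set} → (A → Bool) → List A → Bool
allᵇ p []       = true
allᵇ p (x ∷ xs) = p x ∧ allᵇ p xs

ind : Bool → ℕ
ind true  = 1
ind false = 0

vertices : ℕ → List (ℕ × ℕ)
vertices n = concatMap (λ x → map (λ y → (x , y)) (map suc (upTo n))) (map suc (upTo n))

-- Horizontal / vertical edges (shared by 6V and 20V; same boundary)
-- Conventions (coordinates in ℕ):
--   east H x y  (0 ≤ x ≤ n, 1 ≤ y ≤ n): true iff the horizontal edge
--     {(x,y),(x+1,y)} is oriented from (x,y) to (x+1,y).
--     Inner edge (1 ≤ x ≤ n-1): H (x-1) (y-1).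
--   north V x y (1 ≤ x ≤ n, 0 ≤ y ≤ n): true iff the vertical edge
--     {(x,y),(x,y+1)} is oriented from (x,y) to (x,y+1).
--     Inner edge (1 ≤ y ≤ n-1): V (x-1) (y-1).

HorOr : ℕ → Set
HorOr n = Fin (n ∸ 1) → Fin n → Bool

VerOr : ℕ → Set
VerOr n = Fin n → Fin (n ∸ 1) → Bool

east : (n : ℕ) → HorOr n → ℕ → ℕ → Bool
east n H x y =
  if x ≡ᵇ 0 then true
  else if x ≡ᵇ n then false
  else at2 H (x ∸ 1) (y ∸ 1)

north : (n : ℕ) → VerOr n → ℕ → ℕ → Bool
north n V x y =
  if y ≡ᵇ 0 then false
  else if y ≡ᵇ n then true
  else at2 V (x ∸ 1) (y ∸ 1)

-- Twenty-vertex model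
-- Diagonal edges {(a,b+1),(a+1,b)} for 0 ≤ a,b ≤ n.
--   se D a b : true iff oriented from (a,b+1) to (a+1,b).
--   Inner (1 ≤ a,b ≤ n-1): D (a-1) (b-1).

DiaOr : ℕ → Set
DiaOr n = Fin (n ∸ 1) → Fin (n ∸ 1) → Bool

data DWBC : Set where
  DWBC1 DWBC2 : DWBC

corner : DWBC → Bool
corner DWBC1 = true    -- (0,n+1) → (1,n)  and  (n,1) → (n+1,0)
corner DWBC2 = false   -- (1,n) → (0,n+1)  and  (n+1,0) → (n,1)

se : DWBC → (n : ℕ) → DiaOr n → ℕ → ℕ → Bool
se bc n D a b =
  if (a ≡ᵇ 0) ∧ (b ≡ᵇ n) then corner bc
  else if (a ≡ᵇ n) ∧ (b ≡ᵇ 0) then corner bc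
  else if a ≡ᵇ 0 then true
  else if b ≡ᵇ 0 then true
  else if a ≡ᵇ n then false
  else if b ≡ᵇ n then false
  else at2 D (a ∸ 1) (b ∸ 1)

record Config20 (n : ℕ) : Set where
  constructor cfg20
  field
    hor : HorOr n
    ver : VerOr n
    dia : DiaOr n

indeg20 : DWBC → (n : ℕ) → Config20 n → ℕ → ℕ → ℕ
indeg20 bc n (cfg20 H V D) x y =
    ind (east n H (x ∸ 1) y)
  + ind (not (east n H x y))
  + ind (north n V x (y ∸ 1))
  + ind (not (north n V x y))
  + ind (not (se bc n D x (y ∸ 1)))
  + ind (se bc n D (x ∸ 1) y)

-- 3 in, 3 out (each vertex has exactly six incident edges)
isConfig20 : DWBC → (n : ℕ) → Config20 n → Bool
isConfig20 bc n c = allᵇ (λ { (x , y) → indeg20 bc n c x y ≡ᵇ 3 }) (vertices n)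

allOrientations20 : (n : ℕ) → List (Config20 n)
allOrientations20 n =
  concatMap (λ H → concatMap (λ V → map (λ D → cfg20 H V D)
      (allArrays (n ∸ 1) (n ∸ 1))) (allArrays n (n ∸ 1))) (allArrays (n ∸ 1) n)

numConfigs20 : DWBC → ℕ → ℕ
numConfigs20 bc n = length (filterᵇ (isConfig20 bc n) (allOrientations20 n))

record Config6 (n : ℕ) : Set where
  constructor cfg6
  field
    hor : HorOr n
    ver : VerOr n

indeg6 : (n : ℕ) → Config6 n → ℕ → ℕ → ℕ
indeg6 n (cfg6 H V) x y =
    ind (east n H (x ∸ 1) y)
  + ind (not (east n H x y))
  + ind (north n V x (y ∸ 1))
  + ind (not (north n V x y))

isConfig6 : (n : ℕ) → Config6 n → Bool
isConfig6 n c = allᵇ (λ { (x , y) → indeg6 n c x y ≡ᵇ 2 }) (vertices n)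

allOrientations6 : (n : ℕ) → List (Config6 n)
allOrientations6 n =
  concatMap (λ H → map (λ V → cfg6 H V) (allArrays n (n ∸ 1))) (allArrays (n ∸ 1) n)

configs6 : (n : ℕ) → List (Config6 n)
configs6 n = filterᵇ (isConfig6 n) (allOrientations6 n)

-- occupied: horizontal oriented W→E, vertical oriented N→S
isTypeB : (n : ℕ) → Config6 n → ℕ → ℕ → Bool
isTypeB n (cfg6 H V) x y =
  let W = east n H (x ∸ 1) y
      E = east n H x y
      S = not (north n V x (y ∸ 1))
      N = not (north n V x y)
  in (W ∧ E ∧ not S ∧ not N) ∨ (S ∧ N ∧ not W ∧ not E)

numB : (n : ℕ) → Config6 n → ℕ
numB n c = length (filterᵇ (λ { (x , y) → isTypeB n c x y }) (vertices n))

-- ℕ[√2]: the element p + q √2 is represented by the pair (p , q).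
-- Since 1 and √2 are linearly independent over ℚ, this representation is
-- faithful (equality of pairs = equality of real numbers).

record ℕ√2 : Set where
  constructor _+_√2
  field
    rat : ℕ
    irr : ℕ

infix 5 _+_√2

_⊕_ : ℕ√2 → ℕ√2 → ℕ√2
(p + q √2) ⊕ (p' + q' √2) = (p + p') + (q + q') √2

times√2 : ℕ√2 → ℕ√2
times√2 (p + q √2) = (2 * q) + p √2

fromℕ : ℕ → ℕ√2
fromℕ k = k + 0 √2

√2^ : ℕ → ℕ√2
√2^ zero    = 1 + 0 √2
√2^ (suc k) = times√2 (√2^ k)

Z6V : ℕ → ℕ√2
Z6V n = foldr (λ c acc → √2^ (numB n c) ⊕ acc) (0 + 0 √2) (configs6 n)

{-# OPTIONS --safe #-}
module Submission where

-- Call an edge occupied when it is oriented eastwards, northwards or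
-- south-eastwards; the ice rules say that every vertex conserves the number of
-- occupied edges. Moving the diagonal line slightly off a twenty-vertex node
-- leaves three six-vertex crossings, and for suitable weights (√2 and 1 between
-- horizontal and vertical lines) their product gives weight 1 to all twenty
-- vertices, on whichever side of the node the diagonal passes. By this
-- Yang–Baxter move the diagonals issued from the occupied West boundary slide
-- to the lower left corner, and those ending on the empty East boundary to the
-- upper right corner, where all their crossings are frozen. The diagonal between
-- the two corners can go either way, according to its orientation. What
-- remains is the six-vertex model.

open import Defs
open import Algebra.Properties.Group using (∙-cancelˡ)
open import Algebra.Structures using (IsCommutativeSemiring)
open import Data.Bool using (Bool; true; false; if_then_else_; not; _∧_; _∨_)
open import Data.Bool.Properties using (∧-identityʳ; ∧-zeroʳ)
open import Data.Empty using (⊥-elim)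
open import Data.Fin using (Fin; zero; suc)
open import Data.List using (List; []; _∷_; _++_; _∷ʳ_; map; concatMap; replicate; filterᵇ; length; upTo; applyUpTo; foldr)
import Data.List.Properties as Listₚ
open import Data.Nat using (ℕ; zero; suc; _≤_; _<_; z≤n; s≤s; _≡ᵇ_)
import Data.Nat as ℕ
import Data.Nat.Properties as ℕₚ
open import Data.Product using (_×_; _,_; proj₁; proj₂)
open import Data.Product.Properties using (≡-dec)
open import Data.Rational using (ℚ; 0ℚ; 1ℚ; ½)
import Data.Rational as ℚ
import Data.Rational.Properties as ℚₚ
open import Data.Rational.Solver using (module +-*-Solver)
open import Data.Unit using (tt)
open import Function using (_∘_; id; const)
open import Relation.Binary.Definitions using (DecidableEquality)
open import Relation.Binary.PropositionalEquality using (_≡_; refl; sym; trans; cong; cong₂; module ≡-Reasoning; isEquivalence)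
open import Relation.Nullary using (¬_)
open import Relation.Nullary.Decidable using (Dec; toWitness; map′; _×-dec_)

-- Let a, b, c be the weights of a crossing whose two states are equal, differ and go straight on,
-- or differ and are exchanged. Then (a, b, c) is (√2, 1, 1) for horizontal with vertical, (1, √2,
-- 1)/√2 for diagonal with vertical and (√2, 1, 1)/√2 for horizontal with diagonal. All three have
-- (a² + b² - c²)/(2ab) = 1/√2, the common anisotropy that a Yang-Baxter relation asks for. The
-- obstacle is bookkeeping: between two columns one diagonal leaves at the bottom and another enters
-- on top, so the columns change shape while the diagonals slide. A column is therefore a word of
-- crossings that acts on functions of edge lists. The same column of nodes can be opened with its
-- crossings on the left or on the right; equating the two results carries crossings through opened
-- columns, and no crossing ever has to be inverted. Each slide is an induction over the columns,
-- and the crossings set free in a column are absorbed by a boundary on which all edges have the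
-- same state.

_≡ᴮ_ : Bool → Bool → Bool
true  ≡ᴮ b = b
false ≡ᴮ b = not b

-- Opaque, since the summand of an unfolded sum over these lists cannot be inferred.
opaque
  bools² : List (Bool × Bool)
  bools² = concatMap (λ a → map (a ,_) bools) bools

  bools³ : List (Bool × Bool × Bool)
  bools³ = concatMap (λ a → map (a ,_) bools²) bools

_≡²_ : Bool × Bool → Bool × Bool → Bool
(a , b) ≡² (a′ , b′) = (a ≡ᴮ a′) ∧ (b ≡ᴮ b′)

_≡³_ : Bool × Bool × Bool → Bool × Bool × Bool → Bool
(a , b) ≡³ (a′ , b′) = (a ≡ᴮ a′) ∧ (b ≡² b′)

-- Columns as words of crossings

-- A vertical line runs upwards through a word of cells. A node is a twenty-vertex
-- vertex: it reads a horizontal edge and the diagonal edge above it, and leaves the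
-- diagonal edge below the next horizontal one.
data Line : Set where
  hor dia : Line

data Cell : Set where
  line : Line → Cell
  node : Cell

-- A hole marks the crossing of a horizontal line with the diagonal above it; it is
-- filled by a node, or by the two lines before or after they cross.
data Hole : Set where
  cell : Cell → Hole
  hole : Hole

pattern H = line hor
pattern D = line dia

fill : List Cell → List Hole → List Cell
fill p []           = []
fill p (cell c ∷ s) = c ∷ fill p s
fill p (hole ∷ s)   = p ++ fill p s

fill-++ : ∀ p s t → fill p (s ++ t) ≡ fill p s ++ fill p t
fill-++ p []           t = refl
fill-++ p (cell c ∷ s) t = cong (c ∷_) (fill-++ p s t)
fill-++ p (hole ∷ s)   t =
  trans (cong (p ++_) (fill-++ p s t)) (sym (Listₚ.++-assoc p (fill p s) (fill p t)))

fill-cells : ∀ p m c → fill p (replicate m (cell c)) ≡ replicate m c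
fill-cells p zero    c = refl
fill-cells p (suc m) c = cong (c ∷_) (fill-cells p m c)

fill-nodes : ∀ m → fill (node ∷ []) (replicate m hole) ≡ replicate m node
fill-nodes zero    = refl
fill-nodes (suc m) = cong (node ∷_) (fill-nodes m)

hd dh : List Cell
hd = H ∷ D ∷ []
dh = D ∷ H ∷ []

data Slot : Set where
  keep swap : Slot

-- Slots follow the edges beside a column and not its cells: a node touches two edges, which stay in
-- place, and a hole touches two edges, which cross.
slots : List Hole → List Slot
slots []                = []
slots (cell H ∷ s)      = keep ∷ slots s
slots (cell D ∷ s)      = keep ∷ slots s
slots (cell node ∷ s)   = keep ∷ keep ∷ slots s
slots (hole ∷ s)        = swap ∷ slots s

ones : List Slot → List Bool
ones []         = []
ones (keep ∷ s) = true ∷ ones s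
ones (swap ∷ s) = true ∷ true ∷ ones s

nodes-fill : ∀ p m s → replicate m node ++ fill p s ≡ fill p (replicate m (cell node) ++ s)
nodes-fill p m s =
  sym (trans (fill-++ p (replicate m (cell node)) s) (cong (_++ fill p s) (fill-cells p m node)))

-- Once the lowest diagonal has left, the edges on the right of `suc m` nodes are read by `m` nodes
-- and one horizontal line: both take `2m + 1` edges below `s`.
slots-nodes : ∀ m s → slots (replicate (suc m) (cell node) ++ s) ≡
              keep ∷ slots (replicate m (cell node) ++ cell H ∷ s)
slots-nodes zero    s = refl
slots-nodes (suc m) s = cong (λ t → keep ∷ keep ∷ t) (slots-nodes m s)

-- An alternating word can be bracketed in two ways. Splitting off the lowest horizontal line and
-- the topmost diagonal turns the pairs `hd` into pairs `dh`, on which the crossings can act again.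
hd-shift : ∀ u s → fill hd (replicate (suc u) hole ++ s) ≡ H ∷ fill dh (replicate u hole) ++ D ∷ fill hd s
hd-shift zero    s = refl
hd-shift (suc u) s = cong (λ t → H ∷ D ∷ t) (hd-shift u s)

-- The `m` holes belong to the diagonals that have not yet left; the `r` horizontal lines above them
-- are already free of diagonals.
staircase : ℕ → ℕ → List Hole
staircase m r = replicate m hole ++ replicate r (cell H)

dh-shift : ∀ m r → H ∷ fill dh (staircase m r) ≡ fill hd (staircase m (suc r))
dh-shift zero    r = cong (H ∷_) (trans (fill-cells dh r H) (sym (fill-cells hd r H)))
dh-shift (suc m) r = cong (λ t → H ∷ D ∷ t) (dh-shift m r)

ones-shift : ∀ m r → true ∷ ones (slots (staircase m r)) ≡ ones (slots (staircase m (suc r)))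
ones-shift zero    r = refl
ones-shift (suc m) r = cong (λ t → true ∷ true ∷ t) (ones-shift m r)

-- Arrays of edges completed by their boundary values

fence : {A : Set} {k : ℕ} → A → (Fin k → A) → A → ℕ → A
fence l f r zero    = l
fence l f r (suc i) = at f i r

fence-suc : {A B : Set} {k : ℕ} (e : A → B) (l : B) (f : Fin (suc k) → A) (r : B) → ∀ i →
           fence l (e ∘ f) r (suc i) ≡ fence (e (f zero)) (e ∘ f ∘ suc) r i
fence-suc e l f r zero    = refl
fence-suc e l f r (suc i) = refl

-- The default is not arbitrary: for diagonals, `false` beyond the end is the orientation of the
-- edges on the North boundary.
bit : {k : ℕ} → (Fin k → Bool) → ℕ → Bool
bit f j = at f j false

-- Node `j` reads its horizontal edge and the diagonal above it, which has position `j + 1`, but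
-- leaves the diagonal below it, which has position `j`. Hence the shift between the two lists.
outs ins : ℕ → (ℕ → Bool) → (ℕ → Bool) → List Bool
outs zero    g e = []
outs (suc n) g e = g 0 ∷ e 0 ∷ outs n (g ∘ suc) (e ∘ suc)
ins zero    e g = []
ins (suc n) e g = e 0 ∷ g 1 ∷ ins n (e ∘ suc) (g ∘ suc)

bits : ℕ → (ℕ → Bool) → List Bool
bits zero    e = []
bits (suc n) e = e 0 ∷ bits n (e ∘ suc)

at-map : {A B : Set} {k : ℕ} (F : A → B) (f : Fin k → A) (d : A) → ∀ i → at (F ∘ f) i (F d) ≡ F (at f i d)
at-map {k = zero}  F f d i       = refl
at-map {k = suc k} F f d zero    = refl
at-map {k = suc k} F f d (suc i) = at-map F (f ∘ suc) d i

at-const : {A : Set} {k : ℕ} (d : A) → ∀ i → at {k = k} (λ _ → d) i d ≡ d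
at-const {k = zero}  d i       = refl
at-const {k = suc k} d zero    = refl
at-const {k = suc k} d (suc i) = at-const {k = k} d i

at-end : {A : Set} {k : ℕ} (f : Fin k → A) (d : A) → at f k d ≡ d
at-end {k = zero}  f d = refl
at-end {k = suc k} f d = at-end (f ∘ suc) d

at-if : {A : Set} {k : ℕ} (f : Fin k → A) (d d′ : A) → ∀ i → i ≤ k →
        (if i ≡ᵇ k then d else at f i d′) ≡ at f i d
at-if {k = zero}  f d d′ zero    z≤n     = refl
at-if {k = suc k} f d d′ zero    z≤n     = refl
at-if {k = suc k} f d d′ (suc i) (s≤s p) = at-if (f ∘ suc) d d′ i p

-- The added value is the diagonal edge on the South boundary.
cons : {k : ℕ} → Bool → (Fin k → Bool) → ℕ → Bool
cons b f zero    = b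
cons b f (suc j) = bit f j

bit-cons : {k : ℕ} (f : Fin (suc k) → Bool) → ∀ j → bit f j ≡ cons (f zero) (f ∘ suc) j
bit-cons f zero    = refl
bit-cons f (suc j) = refl

-- The diagonal edges left of the first and right of the last column, with the
-- corner edges oriented as c; position j is the edge between heights j and j + 1.
leftDia : Bool → ℕ → ℕ → Bool
leftDia c n j = if j ≡ᵇ n then c else true

rightDia : Bool → ℕ → Bool
rightDia c zero    = c
rightDia c (suc _) = false

outs-cong : ∀ n {g g′} e → (∀ j → g j ≡ g′ j) → outs n g e ≡ outs n g′ e
outs-cong zero    e eq = refl
outs-cong (suc n) e eq = cong₂ (λ b o → b ∷ e 0 ∷ o) (eq 0) (outs-cong n (e ∘ suc) (eq ∘ suc))

outs-ins : ∀ n e g → e 0 ∷ (outs n (g ∘ suc) (e ∘ suc) ∷ʳ g (suc n)) ≡ ins (suc n) e g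
outs-ins zero    e g = refl
outs-ins (suc n) e g = cong (λ o → e 0 ∷ g 1 ∷ o) (outs-ins n (e ∘ suc) (g ∘ suc))

ins-left-DWBC1 : ∀ k → ins (suc k) (const true) (leftDia true (suc k)) ≡ ones (slots (staircase (suc k) 0))
ins-left-DWBC1 zero    = refl
ins-left-DWBC1 (suc k) = cong (λ o → true ∷ true ∷ o) (ins-left-DWBC1 k)

ins-left-DWBC2 : ∀ k → ins (suc k) (const true) (leftDia false (suc k)) ≡ ones (slots (staircase k 1)) ∷ʳ false
ins-left-DWBC2 zero    = refl
ins-left-DWBC2 (suc k) = cong (λ o → true ∷ true ∷ o) (ins-left-DWBC2 k)

bits-true : ∀ n → bits n (const true) ≡ ones (slots (replicate n (cell H)))
bits-true zero    = refl
bits-true (suc n) = cong (true ∷_) (bits-true n)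

east-fence : ∀ k (h : HorOr (suc k)) i j → i ≤ suc k →
             east (suc k) h i (suc j) ≡ fence (const true) (bit ∘ h) (const false) i j
east-fence k h zero    j p       = refl
east-fence k h (suc i) j (s≤s p) =
  trans (at-if (λ r → at (h r) j false) false false i p) (at-map (λ f → f j) (bit ∘ h) (const false) i)

north-fence : ∀ k (v : VerOr (suc k)) i j → j ≤ suc k →
              north (suc k) v (suc i) j ≡ fence false (at v i (const false)) true j
north-fence k v i zero    p       = refl
north-fence k v i (suc j) (s≤s p) =
  trans (cong (λ b → if j ≡ᵇ k then true else b)
          (trans (cong (at (λ r → at (v r) j false) i) (sym (at-const {k = k} false j)))
                 (at-map (λ f → at f j false) v (const false) i)))
        (at-if (at v i (const false)) true false j p)

se-fence : ∀ bc k (d : DiaOr (suc k)) i j → i ≤ suc k → j ≤ suc k →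
           se bc (suc k) d i j ≡ fence (leftDia (corner bc) (suc k)) (cons true ∘ d) (rightDia (corner bc)) i j
se-fence bc k d zero    j       p       q       = refl
se-fence bc k d (suc i) zero    (s≤s p) q       = begin
  (if (i ≡ᵇ k) ∧ true then corner bc else true)
    ≡⟨ cong (λ b → if (i ≡ᵇ k) ∧ true then corner bc else b) (sym (at-const {k = k} true i)) ⟩
  (if (i ≡ᵇ k) ∧ true then corner bc else at {k = k} (λ _ → true) i true)
    ≡⟨ cong (λ b → if b then corner bc else at {k = k} (λ _ → true) i true) (∧-identityʳ (i ≡ᵇ k)) ⟩
  (if i ≡ᵇ k then corner bc else at {k = k} (λ _ → true) i true)
    ≡⟨ at-if {k = k} (λ _ → true) (corner bc) true i p ⟩
  at {k = k} (λ _ → true) i (corner bc)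
    ≡⟨ at-map (λ f → f 0) (cons true ∘ d) (rightDia (corner bc)) i ⟩
  at (cons true ∘ d) i (rightDia (corner bc)) 0 ∎
  where
  open ≡-Reasoning
se-fence bc k d (suc i) (suc j) (s≤s p) (s≤s q) = begin
  (if (i ≡ᵇ k) ∧ false then corner bc else if i ≡ᵇ k then false else if j ≡ᵇ k then false else at2 d i j)
    ≡⟨ cong (λ b → if b then corner bc else if i ≡ᵇ k then false else if j ≡ᵇ k then false else at2 d i j)
            (∧-zeroʳ (i ≡ᵇ k)) ⟩
  (if i ≡ᵇ k then false else if j ≡ᵇ k then false else at2 d i j)
    ≡⟨ cong (λ b → if i ≡ᵇ k then false else b) inner ⟩
  (if i ≡ᵇ k then false else at2 d i j)
    ≡⟨ at-if (λ r → at (d r) j false) false false i p ⟩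
  at2 d i j
    ≡⟨ at-map (λ f → f (suc j)) (cons true ∘ d) (rightDia (corner bc)) i ⟩
  at (cons true ∘ d) i (rightDia (corner bc)) (suc j) ∎
  where
  open ≡-Reasoning
  at2-swap : at2 d i j ≡ at (at d i (const false)) j false
  at2-swap = trans (cong (at (λ r → at (d r) j false) i) (sym (at-const {k = k} false j)))
                   (at-map (λ f → at f j false) d (const false) i)
  inner : (if j ≡ᵇ k then false else at2 d i j) ≡ at2 d i j
  inner = trans (cong (λ b → if j ≡ᵇ k then false else b) at2-swap)
          (trans (at-if (at d i (const false)) false false j q) (sym at2-swap))

-- Finite sums and linear functionals over a commutative semiring

module Semiring {R : Set} (_+_ _*_ : R → R → R) (0# 1# : R)
  (isCommutativeSemiring : IsCommutativeSemiring _≡_ _+_ _*_ 0# 1#) where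

  open IsCommutativeSemiring isCommutativeSemiring public
    using (+-identityˡ; +-identityʳ; +-assoc; +-comm; *-identityˡ; *-identityʳ; *-assoc; *-comm;
           zeroˡ; zeroʳ; distribˡ)

  +-interchange : ∀ a b c d → (a + b) + (c + d) ≡ (a + c) + (b + d)
  +-interchange a b c d = begin
    (a + b) + (c + d) ≡⟨ +-assoc a b (c + d) ⟩
    a + (b + (c + d)) ≡⟨ cong (a +_) (sym (+-assoc b c d)) ⟩
    a + ((b + c) + d) ≡⟨ cong (λ t → a + (t + d)) (+-comm b c) ⟩
    a + ((c + b) + d) ≡⟨ cong (a +_) (+-assoc c b d) ⟩
    a + (c + (b + d)) ≡⟨ sym (+-assoc a c (b + d)) ⟩
    (a + c) + (b + d) ∎
    where open ≡-Reasoning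

  *-left-comm : ∀ a b c → a * (b * c) ≡ b * (a * c)
  *-left-comm a b c =
    trans (sym (*-assoc a b c)) (trans (cong (_* c) (*-comm a b)) (*-assoc b a c))

  ∑ : {A : Set} → List A → (A → R) → R
  ∑ []       f = 0#
  ∑ (x ∷ xs) f = f x + ∑ xs f

  𝟙 : Bool → R
  𝟙 b = if b then 1# else 0#

  ∑-cong : {A : Set} (xs : List A) {f g : A → R} → (∀ x → f x ≡ g x) → ∑ xs f ≡ ∑ xs g
  ∑-cong []       eq = refl
  ∑-cong (x ∷ xs) eq = cong₂ _+_ (eq x) (∑-cong xs eq)

  ∑-+ : {A : Set} (xs : List A) (f g : A → R) → ∑ xs (λ x → f x + g x) ≡ ∑ xs f + ∑ xs g
  ∑-+ []       f g = sym (+-identityˡ 0#)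
  ∑-+ (x ∷ xs) f g = trans (cong ((f x + g x) +_) (∑-+ xs f g)) (+-interchange _ _ _ _)

  ∑-* : {A : Set} (xs : List A) (k : R) (f : A → R) → ∑ xs (λ x → k * f x) ≡ k * ∑ xs f
  ∑-* []       k f = sym (zeroʳ k)
  ∑-* (x ∷ xs) k f = trans (cong ((k * f x) +_) (∑-* xs k f)) (sym (distribˡ k _ _))

  ∑-filterᵇ : {A : Set} (p : A → Bool) (xs : List A) (f : A → R) →
              ∑ (filterᵇ p xs) f ≡ ∑ xs (λ x → 𝟙 (p x) * f x)
  ∑-filterᵇ p []       f = refl
  ∑-filterᵇ p (x ∷ xs) f with p x
  ... | true  = cong₂ _+_ (sym (*-identityˡ _)) (∑-filterᵇ p xs f)
  ... | false = trans (∑-filterᵇ p xs f) (sym (trans (cong (_+ ∑ xs (λ y → 𝟙 (p y) * f y)) (zeroˡ (f x))) (+-identityˡ _)))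

  opaque
    unfolding bools²

    ∑-single² : ∀ i (f : Bool × Bool → R) → ∑ (filterᵇ (_≡² i) bools²) f ≡ f i
    ∑-single² (true  , true)  f = +-identityʳ _
    ∑-single² (true  , false) f = +-identityʳ _
    ∑-single² (false , true)  f = +-identityʳ _
    ∑-single² (false , false) f = +-identityʳ _

    ∑-single³ : ∀ i (f : Bool × Bool × Bool → R) → ∑ (filterᵇ (_≡³ i) bools³) f ≡ f i
    ∑-single³ (true  , true  , true)  f = +-identityʳ _
    ∑-single³ (true  , true  , false) f = +-identityʳ _
    ∑-single³ (true  , false , true)  f = +-identityʳ _
    ∑-single³ (true  , false , false) f = +-identityʳ _
    ∑-single³ (false , true  , true)  f = +-identityʳ _
    ∑-single³ (false , true  , false) f = +-identityʳ _
    ∑-single³ (false , false , true)  f = +-identityʳ _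
    ∑-single³ (false , false , false) f = +-identityʳ _

  -- Columns and stacks of crossings are linear in the function applied to their outgoing edges.
  -- Linear functionals commute with weighted finite sums, and this alone lets crossings move past
  -- crossings that share no edge with them.
  record Linear {I : Set} (L : (I → R) → R) : Set where
    field
      resp   : ∀ {f g} → (∀ i → f i ≡ g i) → L f ≡ L g
      +-homo : ∀ f g → L (λ i → f i + g i) ≡ L f + L g
      *-homo : ∀ k f → L (λ i → k * f i) ≡ k * L f

    0-homo : ∀ f → (∀ i → f i ≡ 0#) → L f ≡ 0#
    0-homo f eq = trans (resp (λ i → trans (eq i) (sym (zeroˡ 0#))))
                        (trans (*-homo 0# (λ _ → 0#)) (zeroˡ _))

    ∑-homo : {A : Set} (xs : List A) (F : A → I → R) →
             L (λ i → ∑ xs (λ x → F x i)) ≡ ∑ xs (λ x → L (F x))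
    ∑-homo []       F = 0-homo _ (λ _ → refl)
    ∑-homo (x ∷ xs) F = trans (+-homo (F x) _) (cong (L (F x) +_) (∑-homo xs F))

  open Linear

  lin-at : {I : Set} (i : I) → Linear (λ f → f i)
  lin-at i = record { resp = λ eq → eq i ; +-homo = λ _ _ → refl ; *-homo = λ _ _ → refl }

  lin-zero : {I : Set} → Linear {I} (λ _ → 0#)
  lin-zero = record { resp = λ _ → refl ; +-homo = λ _ _ → sym (+-identityˡ 0#)
                    ; *-homo = λ k _ → sym (zeroʳ k) }

  lin-bind : {I J : Set} {L : (J → R) → R} {M : J → (I → R) → R} →
             Linear L → (∀ j → Linear (M j)) → Linear (λ f → L (λ j → M j f))
  lin-bind l m = record
    { resp   = λ eq → resp l (λ j → resp (m j) eq)
    ; +-homo = λ f g → trans (resp l (λ j → +-homo (m j) f g)) (+-homo l _ _)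
    ; *-homo = λ k f → trans (resp l (λ j → *-homo (m j) k f)) (*-homo l k _)
    }

  lin-∘ : {I J : Set} {L : (J → R) → R} → Linear L → (h : J → I) → Linear (λ f → L (f ∘ h))
  lin-∘ l h = lin-bind l (λ j → lin-at (h j))

  δ-expand : (φ : Bool × Bool × Bool → R) → ∀ i → φ i ≡ ∑ bools³ (λ x → 𝟙 (x ≡³ i) * φ x)
  δ-expand φ i = trans (sym (∑-single³ i φ)) (∑-filterᵇ (_≡³ i) bools³ φ)

  opaque
    act : {A : Set} → List A → (A → R) → (A → R) → R
    act xs k φ = ∑ xs (λ x → k x * φ x)

    lin-act : {A : Set} (xs : List A) (k : A → R) → Linear (act xs k)
    lin-act xs k = record
      { resp   = λ eq → ∑-cong xs (λ x → cong (k x *_) (eq x))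
      ; +-homo = λ f g → trans (∑-cong xs (λ x → distribˡ (k x) (f x) (g x))) (∑-+ xs _ _)
      ; *-homo = λ c f → trans (∑-cong xs (λ x → *-left-comm (k x) c (f x))) (∑-* xs c _)
      }

    act-comm : {A I : Set} {L : (I → R) → R} → Linear L → (xs : List A) (k : A → R)
               (F : A → I → R) → L (λ i → act xs k (λ x → F x i)) ≡ act xs k (λ x → L (F x))
    act-comm l xs k F = trans (∑-homo l xs _) (∑-cong xs (λ x → *-homo l (k x) (F x)))

    act-cong : {A : Set} (xs : List A) {k k′ : A → R} (φ : A → R) → (∀ x → k x * φ x ≡ k′ x * φ x) →
               act xs k φ ≡ act xs k′ φ
    act-cong xs φ eq = ∑-cong xs eq

    act-single : ∀ i {k φ ψ : Bool × Bool → R} → (∀ x → k x * φ x ≡ 𝟙 (x ≡² i) * ψ x) →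
                 act bools² k φ ≡ ψ i
    act-single i {ψ = ψ} eq = begin
      _                                     ≡⟨ ∑-cong bools² eq ⟩
      ∑ bools² (λ x → 𝟙 (x ≡² i) * ψ x)     ≡⟨ sym (∑-filterᵇ (_≡² i) bools² ψ) ⟩
      ∑ (filterᵇ (_≡² i) bools²) ψ          ≡⟨ ∑-single² i ψ ⟩
      ψ i                                   ∎
      where open ≡-Reasoning

    act-filterᵇ : {A : Set} (p : A → Bool) (xs : List A) {k : A → R} (φ : A → R) →
                  (∀ x → p x ≡ false → k x ≡ 0#) →
                  act xs k φ ≡ ∑ (filterᵇ p xs) (λ x → k x * φ x)
    act-filterᵇ p xs {k} φ off = sym (trans (∑-filterᵇ p xs _) (∑-cong xs term))
      where
      term : ∀ x → 𝟙 (p x) * (k x * φ x) ≡ k x * φ x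
      term x with p x in eq
      ... | true  = *-identityˡ _
      ... | false = trans (zeroˡ _) (sym (trans (cong (_* φ x) (off x eq)) (zeroˡ _)))

    -- A linear functional is determined by its values on the eight indicator functions. This
    -- reduces the Yang-Baxter move to finitely many closed equations.
    linear-act : {L : (Bool × Bool × Bool → R) → R} → Linear L → (φ : Bool × Bool × Bool → R) →
                 L φ ≡ act bools³ (λ x → L (λ i → 𝟙 (x ≡³ i))) φ
    linear-act {L} l φ = begin
      L φ                                              ≡⟨ resp l (δ-expand φ) ⟩
      L (λ i → ∑ bools³ (λ x → 𝟙 (x ≡³ i) * φ x))      ≡⟨ ∑-homo l bools³ (λ x i → 𝟙 (x ≡³ i) * φ x) ⟩
      ∑ bools³ (λ x → L (λ i → 𝟙 (x ≡³ i) * φ x))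
        ≡⟨ ∑-cong bools³ (λ x → trans (resp l (λ i → *-comm (𝟙 (x ≡³ i)) (φ x)))
                                (trans (*-homo l (φ x) (λ i → 𝟙 (x ≡³ i))) (*-comm (φ x) _))) ⟩
      act bools³ (λ x → L (λ i → 𝟙 (x ≡³ i))) φ        ∎
      where open ≡-Reasoning

  -- A vertical line in state v crosses a line in state b, leaving (b′ , v′): the
  -- weight is W ℓ v b (b′ , v′). In W× b c (c′ , b′) and W₂₀ v b c (c′ , b′ , v′) the
  -- letter b stands for the horizontal and c for the diagonal line.
  Kernel : Set
  Kernel = Bool → Bool → Bool × Bool → R

  Kernel³ : Set
  Kernel³ = Bool → Bool → Bool → Bool × Bool × Bool → R

  -- The two ways to open a node. If the horizontal and the diagonal line cross on the left of the
  -- vertical line, the diagonal is the lower one there and is met first; if they cross on the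
  -- right, the horizontal line is met first.
  diaFirst horFirst : (Line → Kernel) → Kernel → Bool → Bool → Bool → (Bool × Bool × Bool → R) → R
  diaFirst W W× v b c φ =
    act bools² (W× b c) λ (c₁ , b₁) → act bools² (W dia v c₁) λ (c₂ , v₁) →
    act bools² (W hor v₁ b₁) λ (b₂ , v₂) → φ (c₂ , b₂ , v₂)
  horFirst W W× v b c φ =
    act bools² (W hor v b) λ (b₁ , v₁) → act bools² (W dia v₁ c) λ (c₁ , v₂) →
    act bools² (W× b₁ c₁) λ (c₂ , b₂) → φ (c₂ , b₂ , v₂)

  lin-diaFirst : ∀ W W× v b c → Linear (diaFirst W W× v b c)
  lin-diaFirst W W× v b c =
    lin-bind (lin-act bools² (W× b c)) λ (c₁ , b₁) → lin-bind (lin-act bools² (W dia v c₁)) λ (c₂ , v₁) →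
    lin-∘ (lin-act bools² (W hor v₁ b₁)) λ (b₂ , v₂) → (c₂ , b₂ , v₂)

  lin-horFirst : ∀ W W× v b c → Linear (horFirst W W× v b c)
  lin-horFirst W W× v b c =
    lin-bind (lin-act bools² (W hor v b)) λ (b₁ , v₁) → lin-bind (lin-act bools² (W dia v₁ c)) λ (c₁ , v₂) →
    lin-∘ (lin-act bools² (W× b₁ c₁)) λ (c₂ , b₂) → (c₂ , b₂ , v₂)

  -- Sums over arrays as products of transfer matrices

  ∑-++ : {A : Set} (xs ys : List A) (f : A → R) → ∑ (xs ++ ys) f ≡ ∑ xs f + ∑ ys f
  ∑-++ []       ys f = sym (+-identityˡ _)
  ∑-++ (x ∷ xs) ys f = trans (cong (f x +_) (∑-++ xs ys f)) (sym (+-assoc _ _ _))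

  ∑-map : {A B : Set} (h : A → B) (xs : List A) (f : B → R) → ∑ (map h xs) f ≡ ∑ xs (f ∘ h)
  ∑-map h []       f = refl
  ∑-map h (x ∷ xs) f = cong (f (h x) +_) (∑-map h xs f)

  ∑-concatMap : {A B : Set} (h : A → List B) (xs : List A) (f : B → R) →
                ∑ (concatMap h xs) f ≡ ∑ xs (λ x → ∑ (h x) f)
  ∑-concatMap h []       f = refl
  ∑-concatMap h (x ∷ xs) f = trans (∑-++ (h x) (concatMap h xs) f) (cong (∑ (h x) f +_) (∑-concatMap h xs f))

  ∑-concatMap-map : {A B C : Set} (h : A → B → C) (xs : List A) (ys : List B) (f : C → R) →
                    ∑ (concatMap (λ x → map (h x) ys) xs) f ≡ ∑ xs (λ x → ∑ ys (λ y → f (h x y)))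
  ∑-concatMap-map h xs ys f =
    trans (∑-concatMap (λ x → map (h x) ys) xs f) (∑-cong xs (λ x → ∑-map (h x) ys f))

  ∑-*ʳ : {A : Set} (xs : List A) (f : A → R) (k : R) → ∑ xs (λ x → f x * k) ≡ ∑ xs f * k
  ∑-*ʳ xs f k = trans (∑-cong xs (λ x → *-comm (f x) k)) (trans (∑-* xs k f) (*-comm k _))

  lin-∑ : {A : Set} (xs : List A) → Linear (∑ xs)
  lin-∑ xs = record { resp = ∑-cong xs ; +-homo = ∑-+ xs ; *-homo = ∑-* xs }

  ∑-swap : {A B : Set} (xs : List A) (ys : List B) (f : A → B → R) →
           ∑ xs (λ x → ∑ ys (f x)) ≡ ∑ ys (λ y → ∑ xs (λ x → f x y))
  ∑-swap xs ys f = ∑-homo (lin-∑ xs) ys (λ y x → f x y)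

  ∑-allFuns : {A : Set} (k : ℕ) (xs : List A) (h : A → (Fin k → A) → R) →
              ∑ (allFuns (suc k) xs) (λ f → h (f zero) (f ∘ suc)) ≡ ∑ xs (λ x → ∑ (allFuns k xs) (h x))
  ∑-allFuns k xs h = ∑-concatMap-map _ xs (allFuns k xs) _

  ∏ : ℕ → (ℕ → R) → R
  ∏ zero    f = 1#
  ∏ (suc n) f = f 0 * ∏ n (f ∘ suc)

  ∏-cong : ∀ n {f g} → (∀ i → i < n → f i ≡ g i) → ∏ n f ≡ ∏ n g
  ∏-cong zero    eq = refl
  ∏-cong (suc n) eq = cong₂ _*_ (eq 0 (s≤s z≤n)) (∏-cong n (λ i i<n → eq (suc i) (s≤s i<n)))

  ∏-∑ : {A : Set} (n : ℕ) (xs : List A) (d : A) (w : ℕ → A → R) →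
        ∑ (allFuns n xs) (λ f → ∏ n (λ i → w i (at f i d))) ≡ ∏ n (λ i → ∑ xs (w i))
  ∏-∑ zero    xs d w = +-identityʳ _
  ∏-∑ (suc n) xs d w = begin
    _ ≡⟨ ∑-allFuns n xs (λ x f → w 0 x * ∏ n (λ i → w (suc i) (at f i d))) ⟩
    ∑ xs (λ x → ∑ (allFuns n xs) (λ f → w 0 x * ∏ n (λ i → w (suc i) (at f i d))))
      ≡⟨ ∑-cong xs (λ x → trans (∑-* (allFuns n xs) (w 0 x) _) (cong (w 0 x *_) (∏-∑ n xs d (w ∘ suc)))) ⟩
    ∑ xs (λ x → w 0 x * ∏ n (λ i → ∑ xs (w (suc i))))
      ≡⟨ ∑-*ʳ xs (w 0) _ ⟩
    ∏ (suc n) (λ i → ∑ xs (w i)) ∎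
    where open ≡-Reasoning

  -- An entry of the matrix product of `U 0`, ..., `U k`, where `S` is the summation over an
  -- intermediate index.
  chain : {A : Set} → ((A → R) → R) → ℕ → (ℕ → A → A → R) → A → A → R
  chain S zero    U l r = U 0 l r
  chain S (suc k) U l r = S (λ a → U 0 l a * chain S k (U ∘ suc) a r)

  chain-cong : {A : Set} {S : (A → R) → R} → Linear S → ∀ k {U U′} → (∀ i l r → U i l r ≡ U′ i l r) →
               ∀ l r → chain S k U l r ≡ chain S k U′ l r
  chain-cong lin zero    eq l r = eq 0 l r
  chain-cong lin (suc k) eq l r = resp lin (λ a → cong₂ _*_ (eq 0 l a) (chain-cong lin k (eq ∘ suc) a r))

  chain-allFuns : {A B : Set} (e : A → B) (xs : List A) (k : ℕ) (U : ℕ → B → B → R) (l r : B) →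
    ∑ (allFuns k xs) (λ f → ∏ (suc k) (λ i → U i (fence l (e ∘ f) r i) (fence l (e ∘ f) r (suc i)))) ≡
    chain (λ φ → ∑ xs (φ ∘ e)) k U l r
  chain-allFuns e xs zero    U l r = trans (+-identityʳ _) (*-identityʳ _)
  chain-allFuns e xs (suc k) U l r = begin
    ∑ (allFuns (suc k) xs) (λ f → U 0 l (e (f zero)) *
      ∏ (suc k) (λ i → U (suc i) (fence l (e ∘ f) r (suc i)) (fence l (e ∘ f) r (suc (suc i)))))
      ≡⟨ ∑-cong (allFuns (suc k) xs) (λ f → cong (U 0 l (e (f zero)) *_) (∏-cong (suc k) (λ i _ →
           cong (λ x → U (suc i) x (at (e ∘ f ∘ suc) i r)) (fence-suc e l f r i)))) ⟩
    ∑ (allFuns (suc k) xs) (λ f → h (f zero) (f ∘ suc))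
      ≡⟨ ∑-allFuns k xs h ⟩
    ∑ xs (λ x → ∑ (allFuns k xs) (h x))
      ≡⟨ ∑-cong xs (λ x → trans (∑-* (allFuns k xs) (U 0 l (e x)) _)
                                (cong (U 0 l (e x) *_) (chain-allFuns e xs k (U ∘ suc) (e x) r))) ⟩
    chain (λ φ → ∑ xs (φ ∘ e)) (suc k) U l r ∎
    where
    open ≡-Reasoning
    h = λ x f → U 0 l (e x) * ∏ (suc k) (λ i → U (suc i) (fence (e x) (e ∘ f) r i) (at (e ∘ f) i r))

  chain-allFuns² : {A B A′ B′ : Set} (e : A → B) (e′ : A′ → B′) (xs : List A) (ys : List A′) (k : ℕ)
    (U : ℕ → B × B′ → B × B′ → R) (l : B) (l′ : B′) (r : B) (r′ : B′) →
    ∑ (allFuns k xs) (λ f → ∑ (allFuns k ys) (λ g → ∏ (suc k) (λ i →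
      U i (fence l (e ∘ f) r i , fence l′ (e′ ∘ g) r′ i)
          (fence l (e ∘ f) r (suc i) , fence l′ (e′ ∘ g) r′ (suc i))))) ≡
    chain (λ φ → ∑ xs (λ x → ∑ ys (λ y → φ (e x , e′ y)))) k U (l , l′) (r , r′)
  chain-allFuns² e e′ xs ys zero    U l l′ r r′ =
    trans (+-identityʳ _) (trans (+-identityʳ _) (*-identityʳ _))
  chain-allFuns² e e′ xs ys (suc k) U l l′ r r′ = begin
    _ ≡⟨ ∑-cong (allFuns (suc k) xs) (λ f → ∑-cong (allFuns (suc k) ys) (λ g →
           cong (U 0 (l , l′) (e (f zero) , e′ (g zero)) *_) (∏-cong (suc k) (λ i _ →
             cong₂ (λ x y → U (suc i) (x , y) (at (e ∘ f ∘ suc) i r , at (e′ ∘ g ∘ suc) i r′))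
                   (fence-suc e l f r i) (fence-suc e′ l′ g r′ i))))) ⟩
    ∑ (allFuns (suc k) xs) (λ f → ∑ (allFuns (suc k) ys) (λ g → h (f zero) (f ∘ suc) (g zero) (g ∘ suc)))
      ≡⟨ ∑-allFuns k xs (λ x f → ∑ (allFuns (suc k) ys) (λ g → h x f (g zero) (g ∘ suc))) ⟩
    ∑ xs (λ x → ∑ (allFuns k xs) (λ f → ∑ (allFuns (suc k) ys) (λ g → h x f (g zero) (g ∘ suc))))
      ≡⟨ ∑-cong xs (λ x → ∑-cong (allFuns k xs) (λ f → ∑-allFuns k ys (h x f))) ⟩
    ∑ xs (λ x → ∑ (allFuns k xs) (λ f → ∑ ys (λ y → ∑ (allFuns k ys) (h x f y))))
      ≡⟨ ∑-cong xs (λ x → ∑-swap (allFuns k xs) ys (λ f y → ∑ (allFuns k ys) (h x f y))) ⟩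
    ∑ xs (λ x → ∑ ys (λ y → ∑ (allFuns k xs) (λ f → ∑ (allFuns k ys) (h x f y))))
      ≡⟨ ∑-cong xs (λ x → ∑-cong ys (λ y →
           trans (∑-cong (allFuns k xs) (λ f → ∑-* (allFuns k ys) (U 0 (l , l′) (e x , e′ y)) _))
           (trans (∑-* (allFuns k xs) (U 0 (l , l′) (e x , e′ y)) _)
                  (cong (U 0 (l , l′) (e x , e′ y) *_)
                        (chain-allFuns² e e′ xs ys k (U ∘ suc) (e x) (e′ y) r r′))))) ⟩
    chain (λ φ → ∑ xs (λ x → ∑ ys (λ y → φ (e x , e′ y)))) (suc k) U (l , l′) (r , r′) ∎
    where
    open ≡-Reasoning
    h = λ x f y g → U 0 (l , l′) (e x , e′ y) * ∏ (suc k) (λ i →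
          U (suc i) (fence (e x) (e ∘ f) r i , fence (e′ y) (e′ ∘ g) r′ i) (at (e ∘ f) i r , at (e′ ∘ g) i r′))

  opaque
    ∑ᴮ : (Bool → R) → R
    ∑ᴮ = ∑ bools

    ∑ᴮ≡∑ : ∀ f → ∑ᴮ f ≡ ∑ bools f
    ∑ᴮ≡∑ f = refl

    lin-∑ᴮ : Linear ∑ᴮ
    lin-∑ᴮ = lin-∑ bools

    ∑ᴮ-comm : {I : Set} {L : (I → R) → R} → Linear L → (k : Bool → R) (F : Bool → I → R) →
              L (λ i → ∑ᴮ (λ b → k b * F b i)) ≡ ∑ᴮ (λ b → k b * L (F b))
    ∑ᴮ-comm l k F = trans (∑-homo l bools (λ x i → k x * F x i)) (∑-cong bools (λ x → *-homo l (k x) (F x)))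

    ∑ᴮ-*ʳ : ∀ (f : Bool → R) k → ∑ᴮ (λ b → f b * k) ≡ ∑ᴮ f * k
    ∑ᴮ-*ʳ = ∑-*ʳ bools

    ∑ᴮ-single : ∀ x (f : Bool → R) → ∑ᴮ (λ b → 𝟙 (b ≡ᴮ x) * f b) ≡ f x
    ∑ᴮ-single x f = trans (sym (∑-filterᵇ (_≡ᴮ x) bools f)) (single x)
      where
      single : ∀ x → ∑ (filterᵇ (_≡ᴮ x) bools) f ≡ f x
      single true  = +-identityʳ _
      single false = +-identityʳ _

    ∑ᴮ-true : ∀ (f : Bool → R) a → ∑ᴮ (λ v → f v * (if v then a else 0#)) ≡ f true * a
    ∑ᴮ-true f a = trans (cong ((f true * a) +_) (trans (+-identityʳ _) (zeroʳ _))) (+-identityʳ _)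

    ∑ᴮ-allFuns : (k : ℕ) (h : Bool → (Fin k → Bool) → R) →
                 ∑ (allFuns (suc k) bools) (λ f → h (f zero) (f ∘ suc)) ≡ ∑ᴮ (λ b → ∑ (allFuns k bools) (h b))
    ∑ᴮ-allFuns k h = ∑-allFuns k bools h

  ∑ᴮ-cong : {f g : Bool → R} → (∀ b → f b ≡ g b) → ∑ᴮ f ≡ ∑ᴮ g
  ∑ᴮ-cong = resp lin-∑ᴮ

  ∑ᴮ-* : ∀ k (f : Bool → R) → ∑ᴮ (λ b → k * f b) ≡ k * ∑ᴮ f
  ∑ᴮ-* = *-homo lin-∑ᴮ

  opaque
    unfolding act bools² ∑ᴮ

    act-∑² : ∀ k φ → act bools² k φ ≡ ∑ᴮ (λ a → ∑ᴮ (λ b → k (a , b) * φ (a , b)))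
    act-∑² k φ = ∑-concatMap-map _,_ bools bools (λ x → k x * φ x)

    act-∑³ : ∀ k φ → act bools³ k φ ≡ ∑ᴮ (λ a → act bools² (λ x → k (a , x)) (λ x → φ (a , x)))
    act-∑³ k φ = ∑-concatMap-map _,_ bools bools² (λ x → k x * φ x)

  act-pick² : ∀ k y (f : Bool → R) →
              act bools² k (λ (b , v) → 𝟙 (b ≡ᴮ y) * f v) ≡ ∑ᴮ (λ v → k (y , v) * f v)
  act-pick² k y f = begin
    act bools² k (λ (b , v) → 𝟙 (b ≡ᴮ y) * f v)
      ≡⟨ act-∑² k (λ (b , v) → 𝟙 (b ≡ᴮ y) * f v) ⟩
    ∑ᴮ (λ b → ∑ᴮ (λ v → k (b , v) * (𝟙 (b ≡ᴮ y) * f v)))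
      ≡⟨ ∑ᴮ-cong (λ b → trans (∑ᴮ-cong (λ v → *-left-comm (k (b , v)) (𝟙 (b ≡ᴮ y)) (f v)))
                              (∑ᴮ-* (𝟙 (b ≡ᴮ y)) (λ v → k (b , v) * f v))) ⟩
    ∑ᴮ (λ b → 𝟙 (b ≡ᴮ y) * ∑ᴮ (λ v → k (b , v) * f v))
      ≡⟨ ∑ᴮ-single y (λ b → ∑ᴮ (λ v → k (b , v) * f v)) ⟩
    ∑ᴮ (λ v → k (y , v) * f v) ∎
    where open ≡-Reasoning

  act-pick³ : ∀ k x y (f : Bool → R) →
              act bools³ k (λ (c , b , v) → 𝟙 (c ≡ᴮ x) * (𝟙 (b ≡ᴮ y) * f v)) ≡ ∑ᴮ (λ v → k (x , y , v) * f v)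
  act-pick³ k x y f = begin
    act bools³ k (λ (c , b , v) → 𝟙 (c ≡ᴮ x) * (𝟙 (b ≡ᴮ y) * f v))
      ≡⟨ act-∑³ k (λ (c , b , v) → 𝟙 (c ≡ᴮ x) * (𝟙 (b ≡ᴮ y) * f v)) ⟩
    ∑ᴮ (λ c → act bools² (λ z → k (c , z)) (λ (b , v) → 𝟙 (c ≡ᴮ x) * (𝟙 (b ≡ᴮ y) * f v)))
      ≡⟨ ∑ᴮ-cong (λ c → *-homo (lin-act bools² (λ z → k (c , z))) (𝟙 (c ≡ᴮ x)) (λ (b , v) → 𝟙 (b ≡ᴮ y) * f v)) ⟩
    ∑ᴮ (λ c → 𝟙 (c ≡ᴮ x) * act bools² (λ z → k (c , z)) (λ (b , v) → 𝟙 (b ≡ᴮ y) * f v))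
      ≡⟨ ∑ᴮ-single x (λ c → act bools² (λ z → k (c , z)) (λ (b , v) → 𝟙 (b ≡ᴮ y) * f v)) ⟩
    act bools² (λ z → k (x , z)) (λ (b , v) → 𝟙 (b ≡ᴮ y) * f v)
      ≡⟨ act-pick² (λ z → k (x , z)) y f ⟩
    ∑ᴮ (λ v → k (x , y , v) * f v) ∎
    where open ≡-Reasoning

  matches : List Bool → List Bool → R
  matches []       []       = 1#
  matches []       (_ ∷ _)  = 0#
  matches (_ ∷ _)  []       = 0#
  matches (a ∷ as) (b ∷ bs) = 𝟙 (b ≡ᴮ a) * matches as bs

  -- Counts and powers as sums and products over vertices

  infix 25 #_
  #_ : ℕ → R
  # zero  = 0#
  # suc k = 1# + # k

  infixr 25 _^_
  _^_ : R → ℕ → R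
  r ^ zero  = 1#
  r ^ suc k = r * r ^ k

  #-length : {A : Set} (p : A → Bool) (xs : List A) → # length (filterᵇ p xs) ≡ ∑ xs (λ x → 𝟙 (p x))
  #-length p []       = refl
  #-length p (x ∷ xs) with p x
  ... | true  = cong (1# +_) (#-length p xs)
  ... | false = trans (#-length p xs) (sym (+-identityˡ _))

  ∏ₗ : {A : Set} → List A → (A → R) → R
  ∏ₗ []       f = 1#
  ∏ₗ (x ∷ xs) f = f x * ∏ₗ xs f

  𝟙-allᵇ : {A : Set} (p : A → Bool) (xs : List A) → 𝟙 (allᵇ p xs) ≡ ∏ₗ xs (λ x → 𝟙 (p x))
  𝟙-allᵇ p []       = refl
  𝟙-allᵇ p (x ∷ xs) with p x
  ... | true  = trans (𝟙-allᵇ p xs) (sym (*-identityˡ _))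
  ... | false = sym (zeroˡ _)

  ^-length : {A : Set} (r : R) (p : A → Bool) (xs : List A) →
             r ^ length (filterᵇ p xs) ≡ ∏ₗ xs (λ x → if p x then r else 1#)
  ^-length r p []       = refl
  ^-length r p (x ∷ xs) with p x
  ... | true  = cong (r *_) (^-length r p xs)
  ... | false = trans (^-length r p xs) (sym (*-identityˡ _))

  ∏ₗ-* : {A : Set} (xs : List A) (f g : A → R) → ∏ₗ xs f * ∏ₗ xs g ≡ ∏ₗ xs (λ x → f x * g x)
  ∏ₗ-* []       f g = *-identityˡ 1#
  ∏ₗ-* (x ∷ xs) f g = begin
    (f x * ∏ₗ xs f) * (g x * ∏ₗ xs g) ≡⟨ *-assoc (f x) _ _ ⟩
    f x * (∏ₗ xs f * (g x * ∏ₗ xs g)) ≡⟨ cong (f x *_) (*-left-comm (∏ₗ xs f) (g x) _) ⟩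
    f x * (g x * (∏ₗ xs f * ∏ₗ xs g)) ≡⟨ sym (*-assoc (f x) (g x) _) ⟩
    (f x * g x) * (∏ₗ xs f * ∏ₗ xs g) ≡⟨ cong ((f x * g x) *_) (∏ₗ-* xs f g) ⟩
    (f x * g x) * ∏ₗ xs (λ x → f x * g x) ∎
    where open ≡-Reasoning

  ∏ₗ-++ : {A : Set} (xs ys : List A) (f : A → R) → ∏ₗ (xs ++ ys) f ≡ ∏ₗ xs f * ∏ₗ ys f
  ∏ₗ-++ []       ys f = sym (*-identityˡ _)
  ∏ₗ-++ (x ∷ xs) ys f = trans (cong (f x *_) (∏ₗ-++ xs ys f)) (sym (*-assoc _ _ _))

  ∏ₗ-map : {A B : Set} (h : A → B) (xs : List A) (f : B → R) → ∏ₗ (map h xs) f ≡ ∏ₗ xs (f ∘ h)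
  ∏ₗ-map h []       f = refl
  ∏ₗ-map h (x ∷ xs) f = cong (f (h x) *_) (∏ₗ-map h xs f)

  ∏ₗ-concatMap : {A B : Set} (h : A → List B) (xs : List A) (f : B → R) →
                 ∏ₗ (concatMap h xs) f ≡ ∏ₗ xs (λ x → ∏ₗ (h x) f)
  ∏ₗ-concatMap h []       f = refl
  ∏ₗ-concatMap h (x ∷ xs) f =
    trans (∏ₗ-++ (h x) (concatMap h xs) f) (cong (∏ₗ (h x) f *_) (∏ₗ-concatMap h xs f))

  ∏ₗ-applyUpTo : {A : Set} (h : ℕ → A) (n : ℕ) (f : A → R) → ∏ₗ (applyUpTo h n) f ≡ ∏ n (f ∘ h)
  ∏ₗ-applyUpTo h zero    f = refl
  ∏ₗ-applyUpTo h (suc n) f = cong (f (h 0) *_) (∏ₗ-applyUpTo (h ∘ suc) n f)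

  ∏ₗ-range : ∀ n (f : ℕ → R) → ∏ₗ (map suc (upTo n)) f ≡ ∏ n (f ∘ suc)
  ∏ₗ-range n f = trans (∏ₗ-map suc (upTo n) f) (∏ₗ-applyUpTo id n (f ∘ suc))

  ∏ₗ-vertices : ∀ n (f : ℕ × ℕ → R) → ∏ₗ (vertices n) f ≡ ∏ n (λ i → ∏ n (λ j → f (suc i , suc j)))
  ∏ₗ-vertices n f = begin
    ∏ₗ (vertices n) f
      ≡⟨ ∏ₗ-concatMap (λ x → map (x ,_) (map suc (upTo n))) (map suc (upTo n)) f ⟩
    ∏ₗ (map suc (upTo n)) (λ x → ∏ₗ (map (x ,_) (map suc (upTo n))) f)
      ≡⟨ ∏ₗ-range n _ ⟩
    ∏ n (λ i → ∏ₗ (map (suc i ,_) (map suc (upTo n))) f)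
      ≡⟨ ∏-cong n (λ i _ → trans (∏ₗ-map (suc i ,_) (map suc (upTo n)) f) (∏ₗ-range n (λ y → f (suc i , y)))) ⟩
    ∏ n (λ i → ∏ n (λ j → f (suc i , suc j))) ∎
    where open ≡-Reasoning

  chain-S : {A : Set} {S S′ : (A → R) → R} → (∀ {f g} → (∀ a → f a ≡ g a) → S f ≡ S′ g) →
            ∀ k U l r → chain S k U l r ≡ chain S′ k U l r
  chain-S eq zero    U l r = refl
  chain-S eq (suc k) U l r = eq (λ a → cong (U 0 l a *_) (chain-S eq k (U ∘ suc) a r))

  column-∑ : ∀ k (U : ℕ → Bool → Bool → R) →
    ∑ (allFuns k bools) (λ v → ∏ (suc k) (λ j → U j (fence false v true j) (fence false v true (suc j)))) ≡
    chain ∑ᴮ k U false true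
  column-∑ k U = trans (chain-allFuns id bools k U false true)
                       (chain-S (λ eq → trans (∑-cong bools eq) (sym (∑ᴮ≡∑ _))) k U false true)

  -- Local weights and the crossings they freeze

  -- These are the properties that the sliding rests on. The first two equations are the Yang-Baxter
  -- move, tested on indicators. The other four freeze a crossing at the West boundary, at the East
  -- boundary, and of a vertical line with an empty diagonal at its top or with an occupied diagonal
  -- leaving at its bottom.
  record Weights : Set where
    field
      W    : Line → Kernel
      W×   : Kernel
      W₂₀  : Kernel³

      diaFirst-δ : ∀ v b c x → diaFirst W W× v b c (λ i → 𝟙 (x ≡³ i)) ≡ W₂₀ v b c x
      horFirst-δ : ∀ v b c x → horFirst W W× v b c (λ i → 𝟙 (x ≡³ i)) ≡ W₂₀ v b c x
      ×-full     : ∀ x → W× true true x ≡ 𝟙 (x ≡² (true , true))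
      ×-empty    : ∀ b c → W× b c (false , false) ≡ 𝟙 ((b , c) ≡² (false , false))
      dia-top    : ∀ v c′ → W dia v false (c′ , true) ≡ 𝟙 ((c′ , v) ≡² (false , true))
      dia-bottom : ∀ c v′ → W dia false c (true , v′) ≡ 𝟙 ((c , v′) ≡² (true , false))

    diaFirst-act : ∀ v b c φ → diaFirst W W× v b c φ ≡ act bools³ (W₂₀ v b c) φ
    diaFirst-act v b c φ =
      trans (linear-act (lin-diaFirst W W× v b c) φ)
            (act-cong bools³ φ (λ x → cong (_* φ x) (diaFirst-δ v b c x)))

    horFirst-act : ∀ v b c φ → horFirst W W× v b c φ ≡ act bools³ (W₂₀ v b c) φ
    horFirst-act v b c φ =
      trans (linear-act (lin-horFirst W W× v b c) φ)
            (act-cong bools³ φ (λ x → cong (_* φ x) (horFirst-δ v b c x)))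

  -- Carrying crossings through columns

  module Transfer (weights : Weights) where

    open Weights weights

    push : Bool → Bool × List Bool → Bool × List Bool
    push b (v , o) = v , b ∷ o

    -- A list whose length does not fit the word gets weight 0, so that no identity
    -- below needs a hypothesis on lengths.
    pass : List Cell → Bool → List Bool → (Bool × List Bool → R) → R
    pass []           v []           K = K (v , [])
    pass []           v (_ ∷ _)      K = 0#
    pass (line ℓ ∷ w) v []           K = 0#
    pass (line ℓ ∷ w) v (b ∷ bs)     K =
      act bools² (W ℓ v b) λ (b′ , v′) → pass w v′ bs (K ∘ push b′)
    pass (node ∷ w)   v []           K = 0#
    pass (node ∷ w)   v (_ ∷ [])     K = 0#
    pass (node ∷ w)   v (b ∷ c ∷ bs) K =
      act bools³ (W₂₀ v b c) λ (c′ , b′ , v′) → pass w v′ bs (K ∘ push c′ ∘ push b′)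

    lin-pass : ∀ w v bs → Linear (pass w v bs)
    lin-pass []           v []           = lin-at _
    lin-pass []           v (_ ∷ _)      = lin-zero
    lin-pass (line ℓ ∷ w) v []           = lin-zero
    lin-pass (line ℓ ∷ w) v (b ∷ bs)     =
      lin-bind (lin-act _ _) λ (b′ , v′) → lin-∘ (lin-pass w v′ bs) _
    lin-pass (node ∷ w)   v []           = lin-zero
    lin-pass (node ∷ w)   v (_ ∷ [])     = lin-zero
    lin-pass (node ∷ w)   v (b ∷ c ∷ bs) =
      lin-bind (lin-act _ _) λ (c′ , b′ , v′) → lin-∘ (lin-pass w v′ bs) _

    -- A stack of crossings of horizontal lines with diagonals, standing between two columns.
    exch : List Slot → List Bool → (List Bool → R) → R
    exch []         bs           φ = φ bs
    exch (keep ∷ s) []           φ = 0#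
    exch (keep ∷ s) (b ∷ bs)     φ = exch s bs (φ ∘ (b ∷_))
    exch (swap ∷ s) []           φ = 0#
    exch (swap ∷ s) (_ ∷ [])     φ = 0#
    exch (swap ∷ s) (b ∷ c ∷ bs) φ =
      act bools² (W× b c) λ (c′ , b′) → exch s bs (λ o → φ (c′ ∷ b′ ∷ o))

    lin-exch : ∀ s bs → Linear (exch s bs)
    lin-exch []         bs           = lin-at bs
    lin-exch (keep ∷ s) []           = lin-zero
    lin-exch (keep ∷ s) (b ∷ bs)     = lin-∘ (lin-exch s bs) _
    lin-exch (swap ∷ s) []           = lin-zero
    lin-exch (swap ∷ s) (_ ∷ [])     = lin-zero
    lin-exch (swap ∷ s) (b ∷ c ∷ bs) = lin-bind (lin-act _ _) λ _ → lin-∘ (lin-exch s bs) _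

    act-zero : {A : Set} (xs : List A) (k : A → R) → act xs k (λ _ → 0#) ≡ 0#
    act-zero xs k = 0-homo (lin-act xs k) _ (λ _ → refl)

    -- Each node at a hole is opened with its crossing on the left. The crossings higher up share no
    -- edge with the part of the column below them, so `act-comm` moves them in front of the whole
    -- column.
    node-diaFirst : ∀ s v bs K → pass (fill (node ∷ []) s) v bs K ≡
                    exch (slots s) bs (λ o → pass (fill dh s) v o K)
    node-diaFirst []             v bs           K = refl
    node-diaFirst (cell H ∷ s)   v []           K = refl
    node-diaFirst (cell H ∷ s)   v (b ∷ bs)     K =
      trans (resp (lin-act _ _) (λ (b′ , v′) → node-diaFirst s v′ bs _))
            (sym (act-comm (lin-exch (slots s) bs) _ _ _))
    node-diaFirst (cell D ∷ s)   v []           K = refl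
    node-diaFirst (cell D ∷ s)   v (b ∷ bs)     K =
      trans (resp (lin-act _ _) (λ (b′ , v′) → node-diaFirst s v′ bs _))
            (sym (act-comm (lin-exch (slots s) bs) _ _ _))
    node-diaFirst (cell node ∷ s) v []           K = refl
    node-diaFirst (cell node ∷ s) v (_ ∷ [])     K = refl
    node-diaFirst (cell node ∷ s) v (b ∷ c ∷ bs) K =
      trans (resp (lin-act _ _) (λ (c′ , b′ , v′) → node-diaFirst s v′ bs _))
            (sym (act-comm (lin-exch (slots s) bs) _ _ _))
    node-diaFirst (hole ∷ s)     v []           K = refl
    node-diaFirst (hole ∷ s)     v (_ ∷ [])     K = refl
    node-diaFirst (hole ∷ s)     v (b ∷ c ∷ bs) K = begin
      act bools³ (W₂₀ v b c) (λ (c₂ , b₂ , v₂) →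
        pass (fill (node ∷ []) s) v₂ bs (K ∘ push c₂ ∘ push b₂))
        ≡⟨ resp (lin-act _ _) (λ (c₂ , b₂ , v₂) → node-diaFirst s v₂ bs _) ⟩
      act bools³ (W₂₀ v b c) (λ (c₂ , b₂ , v₂) →
        exch (slots s) bs (λ o → pass (fill dh s) v₂ o (K ∘ push c₂ ∘ push b₂)))
        ≡⟨ sym (diaFirst-act v b c _) ⟩
      diaFirst W W× v b c (λ (c₂ , b₂ , v₂) →
        exch (slots s) bs (λ o → pass (fill dh s) v₂ o (K ∘ push c₂ ∘ push b₂)))
        ≡⟨ resp (lin-act _ _) (λ _ → sym (trans (act-comm (lin-exch (slots s) bs) _ _ _)
             (resp (lin-act _ _) (λ _ → act-comm (lin-exch (slots s) bs) _ _ _)))) ⟩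
      exch (swap ∷ slots s) (b ∷ c ∷ bs) (λ o → pass (dh ++ fill dh s) v o K) ∎
      where open ≡-Reasoning

    node-horFirst : ∀ s v bs K → pass (fill (node ∷ []) s) v bs K ≡
                    pass (fill hd s) v bs (λ (v′ , o) → exch (slots s) o (λ o′ → K (v′ , o′)))
    node-horFirst []             v []           K = refl
    node-horFirst []             v (_ ∷ _)      K = refl
    node-horFirst (cell H ∷ s)   v []           K = refl
    node-horFirst (cell H ∷ s)   v (b ∷ bs)     K =
      resp (lin-act _ _) (λ (b′ , v′) → node-horFirst s v′ bs _)
    node-horFirst (cell D ∷ s)   v []           K = refl
    node-horFirst (cell D ∷ s)   v (b ∷ bs)     K =
      resp (lin-act _ _) (λ (b′ , v′) → node-horFirst s v′ bs _)
    node-horFirst (cell node ∷ s) v []           K = refl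
    node-horFirst (cell node ∷ s) v (_ ∷ [])     K = refl
    node-horFirst (cell node ∷ s) v (b ∷ c ∷ bs) K =
      resp (lin-act _ _) (λ (c′ , b′ , v′) → node-horFirst s v′ bs _)
    node-horFirst (hole ∷ s)     v []           K = refl
    -- The word `hd` reads the single edge and fails only at its diagonal, so the zero stands inside
    -- a sum.
    node-horFirst (hole ∷ s)     v (_ ∷ [])     K = sym (act-zero _ _)
    node-horFirst (hole ∷ s)     v (b ∷ c ∷ bs) K = begin
      act bools³ (W₂₀ v b c) (λ (c₂ , b₂ , v₂) →
        pass (fill (node ∷ []) s) v₂ bs (K ∘ push c₂ ∘ push b₂))
        ≡⟨ resp (lin-act _ _) (λ (c₂ , b₂ , v₂) → node-horFirst s v₂ bs _) ⟩
      act bools³ (W₂₀ v b c) (λ (c₂ , b₂ , v₂) → pass (fill hd s) v₂ bs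
        (λ (v′ , o) → exch (slots s) o (λ o′ → K (v′ , c₂ ∷ b₂ ∷ o′))))
        ≡⟨ sym (horFirst-act v b c _) ⟩
      horFirst W W× v b c (λ (c₂ , b₂ , v₂) → pass (fill hd s) v₂ bs
        (λ (v′ , o) → exch (slots s) o (λ o′ → K (v′ , c₂ ∷ b₂ ∷ o′))))
        ≡⟨ resp (lin-act _ _) (λ (b₁ , v₁) → resp (lin-act _ _) (λ (c₁ , v₂) →
             sym (act-comm (lin-pass (fill hd s) v₂ bs) _ _ _))) ⟩
      pass (hd ++ fill hd s) v (b ∷ c ∷ bs)
        (λ (v′ , o) → exch (swap ∷ slots s) o (λ o′ → K (v′ , o′))) ∎
      where open ≡-Reasoning

    topped : (List Bool → R) → Bool × List Bool → R
    topped φ (v , o) = if v then φ o else 0#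

    topped-cong : ∀ {φ ψ} → (∀ o → φ o ≡ ψ o) → ∀ p → topped φ p ≡ topped ψ p
    topped-cong eq (true  , o) = eq o
    topped-cong eq (false , o) = refl

    -- The South boundary edge points south, so the vertical line enters empty; the North one points
    -- north, so `topped` keeps only lines that leave occupied.
    col : List Cell → (List Bool → R) → List Bool → R
    col w φ bs = pass w false bs (topped φ)

    col-cong : ∀ w {φ ψ} → (∀ o → φ o ≡ ψ o) → ∀ bs → col w φ bs ≡ col w ψ bs
    col-cong w eq bs = resp (lin-pass w false bs) (topped-cong eq)

    col-horFirst : ∀ s φ bs → col (fill (node ∷ []) s) φ bs ≡
                   col (fill hd s) (λ o → exch (slots s) o φ) bs
    col-horFirst s φ bs = trans (node-horFirst s false bs (topped φ))
                                (resp (lin-pass (fill hd s) false bs) exch-topped)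
      where
      exch-topped : ∀ p → exch (slots s) (proj₂ p) (λ o → topped φ (proj₁ p , o)) ≡
                    topped (λ o → exch (slots s) o φ) p
      exch-topped (true  , o) = refl
      exch-topped (false , o) = 0-homo (lin-exch (slots s) o) _ (λ _ → refl)

    col-diaFirst : ∀ s φ bs → col (fill (node ∷ []) s) φ bs ≡
                   exch (slots s) bs (col (fill dh s) φ)
    col-diaFirst s φ bs = node-diaFirst s false bs (topped φ)

    -- Both sides are the same column of nodes, opened on the left and on the right.
    col-exch : ∀ s φ bs → exch (slots s) bs (col (fill dh s) φ) ≡
               col (fill hd s) (λ o → exch (slots s) o φ) bs
    col-exch s φ bs = trans (sym (col-diaFirst s φ bs)) (col-horFirst s φ bs)

    cols : ℕ → List Cell → (List Bool → R) → List Bool → R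
    cols zero    w φ = φ
    cols (suc j) w φ = col w (cols j w φ)

    cols-cong : ∀ j w {φ ψ} → (∀ o → φ o ≡ ψ o) → ∀ bs → cols j w φ bs ≡ cols j w ψ bs
    cols-cong zero    w eq = eq
    cols-cong (suc j) w eq = col-cong w (cols-cong j w eq)

    cols-+ : ∀ i j w φ → cols i w (cols j w φ) ≡ cols (i ℕ.+ j) w φ
    cols-+ zero    j w φ = refl
    cols-+ (suc i) j w φ = cong (col w) (cols-+ i j w φ)

    cols-exch : ∀ j s φ bs → exch (slots s) bs (cols j (fill dh s) φ) ≡
                cols j (fill hd s) (λ o → exch (slots s) o φ) bs
    cols-exch zero    s φ bs = refl
    cols-exch (suc j) s φ bs =
      trans (col-exch s _ bs) (col-cong (fill hd s) (cols-exch j s φ) bs)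

    -- By conservation two occupied lines can only leave a crossing occupied, with weight 1: the
    -- occupied West boundary absorbs all crossings.
    exch-ones : ∀ s φ → exch s (ones s) φ ≡ φ (ones s)
    exch-ones []         φ = refl
    exch-ones (keep ∷ s) φ = exch-ones s (φ ∘ (true ∷_))
    exch-ones (swap ∷ s) φ =
      trans (act-single (true , true) λ (c , b) →
               cong (_* exch s (ones s) (λ o → φ (c ∷ b ∷ o))) (×-full (c , b)))
            (exch-ones s (λ o → φ (true ∷ true ∷ o)))

    -- Absorption of crossings by the empty boundary

    unoccupied : (List Bool → R) → List Bool → R
    unoccupied φ []          = 0#
    unoccupied φ (true ∷ o)  = 0#
    unoccupied φ (false ∷ o) = φ o

    -- The East boundary: the indicator of an entirely empty edge list whose length fits the word.
    vac : List Cell → List Bool → R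
    vac []           []      = 1#
    vac []           (_ ∷ _) = 0#
    vac (line _ ∷ w)         = unoccupied (vac w)
    vac (node ∷ w)           = unoccupied (unoccupied (vac w))

    vac-node : ∀ s → vac (fill (node ∷ []) s) ≡ vac (fill hd s)
    vac-node []              = refl
    vac-node (cell H ∷ s)    = cong unoccupied (vac-node s)
    vac-node (cell D ∷ s)    = cong unoccupied (vac-node s)
    vac-node (cell node ∷ s) = cong (unoccupied ∘ unoccupied) (vac-node s)
    vac-node (hole ∷ s)      = cong (unoccupied ∘ unoccupied) (vac-node s)

    vac-dh : ∀ s → vac (fill dh s) ≡ vac (fill hd s)
    vac-dh []              = refl
    vac-dh (cell H ∷ s)    = cong unoccupied (vac-dh s)
    vac-dh (cell D ∷ s)    = cong unoccupied (vac-dh s)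
    vac-dh (cell node ∷ s) = cong (unoccupied ∘ unoccupied) (vac-dh s)
    vac-dh (hole ∷ s)      = cong (unoccupied ∘ unoccupied) (vac-dh s)

    vanish : ∀ {a} k {f} → f ≡ 0# → k * f ≡ 0# * a
    vanish k eq = trans (cong (k *_) eq) (trans (zeroʳ k) (sym (zeroˡ _)))

    exch-unoccupied : ∀ s φ bs → exch (keep ∷ s) bs (unoccupied φ) ≡ unoccupied (λ o → exch s o φ) bs
    exch-unoccupied s φ []           = refl
    exch-unoccupied s φ (true ∷ bs)  = 0-homo (lin-exch s bs) _ (λ _ → refl)
    exch-unoccupied s φ (false ∷ bs) = refl

    unoccupied-cong : ∀ {φ ψ} → (∀ o → φ o ≡ ψ o) → ∀ bs → unoccupied φ bs ≡ unoccupied ψ bs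
    unoccupied-cong eq []           = refl
    unoccupied-cong eq (true ∷ bs)  = refl
    unoccupied-cong eq (false ∷ bs) = eq bs

    -- Here the outgoing pair is prescribed: only an empty pair can leave a crossing empty, so the
    -- condition passes to the edges on its left.
    exch-swap-unoccupied : ∀ s φ bs → exch (swap ∷ s) bs (unoccupied (unoccupied φ)) ≡
                           unoccupied (unoccupied (λ o → exch s o φ)) bs
    exch-swap-unoccupied s φ []           = refl
    exch-swap-unoccupied s φ (true ∷ [])  = refl
    exch-swap-unoccupied s φ (false ∷ []) = refl
    exch-swap-unoccupied s φ (b ∷ c ∷ bs) = trans (act-single (false , false) weight) (value b c)
      where
      ψ : Bool × Bool → R
      ψ _ = 𝟙 ((b , c) ≡² (false , false)) * exch s bs φ
      weight : ∀ x → W× b c x * exch s bs (λ o → unoccupied (unoccupied φ) (proj₁ x ∷ proj₂ x ∷ o)) ≡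
               𝟙 (x ≡² (false , false)) * ψ x
      weight (true  , _)     = vanish _ (0-homo (lin-exch s bs) _ (λ _ → refl))
      weight (false , true)  = vanish _ (0-homo (lin-exch s bs) _ (λ _ → refl))
      weight (false , false) = trans (cong (_* exch s bs φ) (×-empty b c)) (sym (*-identityˡ _))
      value : ∀ b c → 𝟙 ((b , c) ≡² (false , false)) * exch s bs φ ≡
              unoccupied (unoccupied (λ o → exch s o φ)) (b ∷ c ∷ bs)
      value true  c     = zeroˡ _
      value false true  = zeroˡ _
      value false false = *-identityˡ _

    exch-vac : ∀ s bs → exch (slots s) bs (vac (fill hd s)) ≡ vac (fill hd s) bs
    exch-vac []              bs = refl
    exch-vac (cell H ∷ s)    bs = trans (exch-unoccupied (slots s) _ bs) (unoccupied-cong (exch-vac s) bs)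
    exch-vac (cell D ∷ s)    bs = trans (exch-unoccupied (slots s) _ bs) (unoccupied-cong (exch-vac s) bs)
    exch-vac (cell node ∷ s) bs =
      trans (exch-unoccupied (keep ∷ slots s) _ bs)
            (unoccupied-cong (λ o → trans (exch-unoccupied (slots s) _ o)
                                          (unoccupied-cong (exch-vac s) o)) bs)
    exch-vac (hole ∷ s)      bs =
      trans (exch-swap-unoccupied (slots s) _ bs)
            (unoccupied-cong (unoccupied-cong (exch-vac s)) bs)

    -- Frozen diagonals at the bottom and at the top

    -- The lowest diagonal leaves the grid occupied, through the South boundary.
    dropTrue : (List Bool → R) → List Bool → R
    dropTrue φ []          = 0#
    dropTrue φ (true ∷ o)  = φ o
    dropTrue φ (false ∷ o) = 0#

    dropTrue-cong : ∀ {φ ψ} → (∀ o → φ o ≡ ψ o) → ∀ bs → dropTrue φ bs ≡ dropTrue ψ bs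
    dropTrue-cong eq []           = refl
    dropTrue-cong eq (true ∷ bs)  = eq bs
    dropTrue-cong eq (false ∷ bs) = refl

    exch-dropTrue : ∀ s φ bs → exch (keep ∷ s) bs (dropTrue φ) ≡ dropTrue (λ o → exch s o φ) bs
    exch-dropTrue s φ []           = refl
    exch-dropTrue s φ (true ∷ bs)  = refl
    exch-dropTrue s φ (false ∷ bs) = 0-homo (lin-exch s bs) _ (λ _ → refl)

    -- The vertical line enters empty and the diagonal has to leave occupied. Conservation forces
    -- the diagonal to enter occupied and the line to stay empty, with weight 1, so the crossing can
    -- be deleted.
    col-bottom : ∀ w φ bs → col (D ∷ w) (dropTrue φ) bs ≡ dropTrue (col w φ) bs
    col-bottom w φ []       = refl
    col-bottom w φ (c ∷ bs) = trans (act-single (true , false) weight) (value c)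
      where
      ψ : Bool × Bool → R
      ψ _ = 𝟙 ((c , false) ≡² (true , false)) * col w φ bs
      empty : ∀ p → topped (dropTrue φ) (push false p) ≡ 0#
      empty (true  , o) = refl
      empty (false , o) = refl
      weight : ∀ x → W dia false c x * pass w (proj₂ x) bs (topped (dropTrue φ) ∘ push (proj₁ x)) ≡
               𝟙 (x ≡² (true , false)) * ψ x
      weight (true  , true)  = trans (cong (_* pass w true bs (topped (dropTrue φ) ∘ push true)) (dia-bottom c true)) (no c)
        where
        no : ∀ c {a b} → 𝟙 ((c , true) ≡² (true , false)) * a ≡ 0# * b
        no true  = trans (zeroˡ _) (sym (zeroˡ _))
        no false = trans (zeroˡ _) (sym (zeroˡ _))
      weight (true  , false) = trans (cong (_* col w φ bs) (dia-bottom c false)) (sym (*-identityˡ _))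
      weight (false , v)     = vanish _ (0-homo (lin-pass w v bs) _ empty)
      value : ∀ c → 𝟙 ((c , false) ≡² (true , false)) * col w φ bs ≡ dropTrue (col w φ) (c ∷ bs)
      value true  = *-identityˡ _
      value false = zeroˡ _

    cols-bottom : ∀ j w φ bs → cols j (D ∷ w) (dropTrue φ) bs ≡ dropTrue (cols j w φ) bs
    cols-bottom zero    w φ bs = refl
    cols-bottom (suc j) w φ bs =
      trans (col-cong (D ∷ w) (cols-bottom j w φ) bs) (col-bottom w (cols j w φ) bs)

    pass-short : ∀ w v {K} → pass (w ∷ʳ D) v [] K ≡ 0#
    pass-short []           v = refl
    pass-short (line _ ∷ w) v = refl
    pass-short (node ∷ w)   v = refl

    pass-top : ∀ w v bs K → pass (w ∷ʳ D) v (bs ∷ʳ false) K ≡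
               pass w v bs (λ (v₁ , o) → act bools² (W dia v₁ false) λ (c , v₂) → K (v₂ , o ∷ʳ c))
    pass-top []           v []           K = refl
    pass-top []           v (b ∷ bs)     K =
      0-homo (lin-act _ _) _ (λ (c , v₂) → nonempty v₂ bs)
      where
      nonempty : ∀ v bs {K} → pass [] v (bs ∷ʳ false) K ≡ 0#
      nonempty v []      = refl
      nonempty v (_ ∷ _) = refl
    pass-top (line ℓ ∷ w) v []           K = 0-homo (lin-act _ _) _ (λ (_ , v₂) → pass-short w v₂)
    pass-top (line ℓ ∷ w) v (b ∷ bs)     K =
      resp (lin-act _ _) (λ (b₁ , v₁) → pass-top w v₁ bs (K ∘ push b₁))
    pass-top (node ∷ w)   v []           K = refl
    pass-top (node ∷ w)   v (b ∷ [])     K = 0-homo (lin-act _ _) _ (λ (_ , _ , v₂) → pass-short w v₂)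
    pass-top (node ∷ w)   v (b ∷ c ∷ bs) K =
      resp (lin-act _ _) (λ (c₁ , b₁ , v₁) → pass-top w v₁ bs (K ∘ push c₁ ∘ push b₁))

    -- The vertical line has to leave occupied, and its last crossing is with an empty diagonal. By
    -- conservation it was occupied before and the diagonal stays empty, with weight 1.
    col-top : ∀ w φ bs → col (w ∷ʳ D) φ (bs ∷ʳ false) ≡ col w (λ o → φ (o ∷ʳ false)) bs
    col-top w φ bs = trans (pass-top w false bs (topped φ)) (resp (lin-pass w false bs) step)
      where
      step : ∀ p → act bools² (W dia (proj₁ p) false) (λ (c , v₂) → topped φ (v₂ , proj₂ p ∷ʳ c)) ≡
             topped (λ o → φ (o ∷ʳ false)) p
      step (v , o) = trans (act-single (false , true) weight) (value v)
        where
        ψ : Bool × Bool → R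
        ψ (c , _) = 𝟙 ((c , v) ≡² (false , true)) * φ (o ∷ʳ c)
        weight : ∀ x → W dia v false x * topped φ (proj₂ x , o ∷ʳ proj₁ x) ≡
                 𝟙 (x ≡² (false , true)) * ψ x
        weight (c     , false) = trans (zeroʳ _) (sym (trans (cong (_* ψ (c , false)) (off c)) (zeroˡ _)))
          where
          off : ∀ c → 𝟙 ((c , false) ≡² (false , true)) ≡ 0#
          off true  = refl
          off false = refl
        weight (true  , true)  = trans (cong (_* φ (o ∷ʳ true)) (dia-top v true)) (trans (zeroˡ _) (sym (zeroˡ _)))
        weight (false , true)  = trans (cong (_* φ (o ∷ʳ false)) (dia-top v false)) (sym (*-identityˡ _))
        value : ∀ v → 𝟙 ((false , v) ≡² (false , true)) * φ (o ∷ʳ false) ≡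
                topped (λ o → φ (o ∷ʳ false)) (v , o)
        value true  = *-identityˡ _
        value false = zeroˡ _

    -- Sliding the diagonals that end on the East boundary

    -- m columns whose lower parts consist of m, m − 1, …, 1 nodes and whose upper parts
    -- cross the word w one line at a time, then δ columns without nodes. From one column
    -- to the next the lowest diagonal leaves and the topmost horizontal line among the
    -- nodes joins w.
    Φ : ℕ → ℕ → List Cell → List Bool → R
    Φ δ zero    w = cols δ w (vac w)
    Φ δ (suc m) w = col (replicate (suc m) node ++ w) (dropTrue (Φ δ m (H ∷ w)))

    -- The crossings on the right of a column touch neither its lowest diagonal nor the edges of its
    -- nodes. They therefore pass the removal of that diagonal and reach the next column, where `s`
    -- has gained a horizontal line at its lower end.
    Φ-step : ∀ δ m s →
      (∀ bs → exch (slots (replicate m (cell node) ++ cell H ∷ s)) bs (Φ δ m (H ∷ fill dh s)) ≡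
              Φ δ m (H ∷ fill hd s) bs) →
      ∀ bs → let t = replicate (suc m) (cell node) ++ s in
      col (fill hd t) (λ o → exch (slots t) o (dropTrue (Φ δ m (H ∷ fill dh s)))) bs ≡
      Φ δ (suc m) (fill hd s) bs
    Φ-step δ m s ih bs =
      trans (col-cong (fill hd t) (λ o →
               trans (cong (λ σ → exch σ o (dropTrue (Φ δ m (H ∷ fill dh s)))) (slots-nodes m s))
               (trans (exch-dropTrue (slots (replicate m (cell node) ++ cell H ∷ s)) _ o)
                      (dropTrue-cong ih o))) bs)
            (cong (λ w → col w (dropTrue (Φ δ m (H ∷ fill hd s))) bs) (sym (nodes-fill hd (suc m) s)))
      where t = replicate (suc m) (cell node) ++ s

    -- The crossings travel to the right through all remaining columns, reversing each pair from
    -- `dh` to `hd`, until `vac` absorbs them.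
    Φ-exch : ∀ δ m s bs → exch (slots (replicate m (cell node) ++ s)) bs (Φ δ m (fill dh s)) ≡
             Φ δ m (fill hd s) bs
    Φ-exch δ zero    s bs = begin
      exch (slots s) bs (cols δ (fill dh s) (vac (fill dh s)))
        ≡⟨ cols-exch δ s _ bs ⟩
      cols δ (fill hd s) (λ o → exch (slots s) o (vac (fill dh s))) bs
        ≡⟨ cols-cong δ (fill hd s) (λ o → trans (cong (exch (slots s) o) (vac-dh s)) (exch-vac s o)) bs ⟩
      cols δ (fill hd s) (vac (fill hd s)) bs ∎
      where open ≡-Reasoning
    Φ-exch δ (suc m) s bs = begin
      exch (slots t) bs (col (replicate (suc m) node ++ fill dh s) φ)
        ≡⟨ cong (λ w → exch (slots t) bs (col w φ)) (nodes-fill dh (suc m) s) ⟩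
      exch (slots t) bs (col (fill dh t) φ)
        ≡⟨ col-exch t φ bs ⟩
      col (fill hd t) (λ o → exch (slots t) o φ) bs
        ≡⟨ Φ-step δ m s (Φ-exch δ m (cell H ∷ s)) bs ⟩
      Φ δ (suc m) (fill hd s) bs ∎
      where
      open ≡-Reasoning
      t = replicate (suc m) (cell node) ++ s
      φ = dropTrue (Φ δ m (H ∷ fill dh s))

    vac-short : ∀ w → vac (w ∷ʳ D) [] ≡ 0#
    vac-short []           = refl
    vac-short (line _ ∷ w) = refl
    vac-short (node ∷ w)   = refl

    vac-top : ∀ w o → vac (w ∷ʳ D) (o ∷ʳ false) ≡ vac w o
    vac-top []           []           = refl
    vac-top []           (true ∷ o)   = refl
    vac-top []           (false ∷ []) = refl
    vac-top []           (false ∷ _ ∷ o) = refl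
    vac-top (line _ ∷ w) []           = vac-short w
    vac-top (line _ ∷ w) (true ∷ o)   = refl
    vac-top (line _ ∷ w) (false ∷ o)  = vac-top w o
    vac-top (node ∷ w)   []           = refl
    vac-top (node ∷ w)   (true ∷ o)   = refl
    vac-top (node ∷ w)   (false ∷ [])  = vac-short w
    vac-top (node ∷ w)   (false ∷ true ∷ o)  = refl
    vac-top (node ∷ w)   (false ∷ false ∷ o)  = vac-top w o

    cols-top : ∀ j w {φ ψ} → (∀ o → φ (o ∷ʳ false) ≡ ψ o) → ∀ o → cols j (w ∷ʳ D) φ (o ∷ʳ false) ≡ cols j w ψ o
    cols-top zero    w eq o = eq o
    cols-top (suc j) w eq o = trans (col-top w _ o) (col-cong w (cols-top j w eq) o)

    dropTrue-top : ∀ {φ ψ} → (∀ o → φ (o ∷ʳ false) ≡ ψ o) → ∀ o → dropTrue φ (o ∷ʳ false) ≡ dropTrue ψ o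
    dropTrue-top eq []          = refl
    dropTrue-top eq (true ∷ o)  = eq o
    dropTrue-top eq (false ∷ o) = refl

    Φ-top : ∀ δ m w o → Φ δ m (w ∷ʳ D) (o ∷ʳ false) ≡ Φ δ m w o
    Φ-top δ zero    w o = cols-top δ w (vac-top w) o
    Φ-top δ (suc m) w o = begin
      col (replicate (suc m) node ++ w ∷ʳ D) φ (o ∷ʳ false)
        ≡⟨ cong (λ w → col w φ (o ∷ʳ false)) (sym (Listₚ.++-assoc (replicate (suc m) node) w (D ∷ []))) ⟩
      col ((replicate (suc m) node ++ w) ∷ʳ D) φ (o ∷ʳ false)
        ≡⟨ col-top (replicate (suc m) node ++ w) φ o ⟩
      col (replicate (suc m) node ++ w) (λ o → φ (o ∷ʳ false)) o
        ≡⟨ col-cong (replicate (suc m) node ++ w) (dropTrue-top (Φ-top δ m (H ∷ w))) o ⟩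
      Φ δ (suc m) w o ∎
      where
      open ≡-Reasoning
      φ = dropTrue (Φ δ m (H ∷ w ∷ʳ D))

    -- The columns of the twenty-vertex model, u of whose m + u diagonals end on the
    -- empty boundary; an empty diagonal enters on top after every column. δ is 0 for
    -- DWBC1 and 1 for DWBC2.
    C : ℕ → ℕ → ℕ → List Bool → R
    C δ zero    u = cols δ (replicate u node) (vac (replicate u node))
    C δ (suc m) u = col (replicate (suc m ℕ.+ u) node) (dropTrue (λ o → C δ m (suc u) (o ∷ʳ false)))

    upper : ℕ → List Cell
    upper u = fill hd (replicate u hole)

    C-zero : ∀ u bs → C 1 0 u bs ≡ Φ 1 0 (upper u) bs
    C-zero u bs = begin
      col (replicate u node) (vac (replicate u node)) bs
        ≡⟨ cong (λ w → col w (vac w) bs) (sym (fill-nodes u)) ⟩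
      col (fill (node ∷ []) s) (vac (fill (node ∷ []) s)) bs
        ≡⟨ col-horFirst s _ bs ⟩
      col (upper u) (λ o → exch (slots s) o (vac (fill (node ∷ []) s))) bs
        ≡⟨ col-cong (upper u) (λ o → trans (cong (exch (slots s) o) (vac-node s)) (exch-vac s o)) bs ⟩
      col (upper u) (vac (upper u)) bs ∎
      where
      open ≡-Reasoning
      s = replicate u hole

    replicate-+ : ∀ m u → replicate (m ℕ.+ u) node ≡ replicate m node ++ replicate u node
    replicate-+ zero    u = refl
    replicate-+ (suc m) u = cong (node ∷_) (replicate-+ m u)

    -- By induction the later columns are already separated into nodes and upper lines. Their
    -- topmost diagonal has entered empty and is deleted by `Φ-top`, which leaves the upper pairs in
    -- the order `dh`. Opening the `u` upper nodes of the present column with crossings on the right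
    -- supplies exactly the crossings that bring these pairs back to `hd`.
    C-Φ : ∀ δ → (∀ u bs → C δ 0 u bs ≡ Φ δ 0 (upper u) bs) →
          ∀ m u bs → C δ m u bs ≡ Φ δ m (upper u) bs
    C-Φ δ base zero    u bs = base u bs
    C-Φ δ base (suc m) u bs = begin
      col (replicate (suc m ℕ.+ u) node) (dropTrue (λ o → C δ m (suc u) (o ∷ʳ false))) bs
        ≡⟨ col-cong (replicate (suc m ℕ.+ u) node) (dropTrue-cong step) bs ⟩
      col (replicate (suc m ℕ.+ u) node) φ bs
        ≡⟨ cong (λ w → col w φ bs) word ⟩
      col (fill (node ∷ []) t) φ bs
        ≡⟨ col-horFirst t φ bs ⟩
      col (fill hd t) (λ o → exch (slots t) o φ) bs
        ≡⟨ Φ-step δ m s (Φ-exch δ m (cell H ∷ s)) bs ⟩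
      Φ δ (suc m) (upper u) bs ∎
      where
      open ≡-Reasoning
      s = replicate u hole
      t = replicate (suc m) (cell node) ++ s
      φ = dropTrue (Φ δ m (H ∷ fill dh s))
      word : replicate (suc m ℕ.+ u) node ≡ fill (node ∷ []) t
      word = trans (replicate-+ (suc m) u)
             (trans (cong (replicate (suc m) node ++_) (sym (fill-nodes u)))
                    (nodes-fill (node ∷ []) (suc m) s))
      upper-suc : upper (suc u) ≡ (H ∷ fill dh s) ∷ʳ D
      upper-suc = trans (cong (fill hd) (sym (Listₚ.++-identityʳ (replicate (suc u) hole)))) (hd-shift u [])
      step : ∀ o → C δ m (suc u) (o ∷ʳ false) ≡ Φ δ m (H ∷ fill dh s) o
      step o = trans (C-Φ δ base m (suc u) (o ∷ʳ false))
               (trans (cong (λ w → Φ δ m w (o ∷ʳ false)) upper-suc)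
                      (Φ-top δ m (H ∷ fill dh s) o))

    -- Sliding the diagonals issued from the West boundary

    sixVertex : ℕ → ℕ → R
    sixVertex j n = cols j (replicate n H) (vac (replicate n H)) (ones (slots (replicate n (cell H))))

    -- The invariant of the second slide: `j` opened columns, crossed by the `m` diagonals that are
    -- left, stand before the columns with nodes. The nodes of the next column are opened with
    -- crossings on the left, which go back through the `j` columns to the occupied boundary.
    Φ-sixVertex : ∀ δ m r j → cols j (fill hd (staircase m r)) (Φ δ m (replicate r H)) (ones (slots (staircase m r))) ≡
                  sixVertex (m ℕ.+ (j ℕ.+ δ)) (m ℕ.+ r)
    Φ-sixVertex δ zero    r j =
      trans (cong (λ w → cols j w (cols δ (replicate r H) (vac (replicate r H))) (ones (slots (staircase 0 r)))) (fill-cells hd r H))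
            (cong (λ f → f (ones (slots (staircase 0 r)))) (cols-+ j δ (replicate r H) (vac (replicate r H))))
    Φ-sixVertex δ (suc m) r j = begin
      cols j (fill hd s) (col (replicate (suc m) node ++ replicate r H) φ) (ones (slots s))
        ≡⟨ cong (λ w → cols j (fill hd s) (col w φ) (ones (slots s))) word ⟩
      cols j (fill hd s) (col (fill (node ∷ []) s) φ) (ones (slots s))
        ≡⟨ cols-cong j (fill hd s) (col-diaFirst s φ) (ones (slots s)) ⟩
      cols j (fill hd s) (λ o → exch (slots s) o (col (fill dh s) φ)) (ones (slots s))
        ≡⟨ sym (cols-exch j s (col (fill dh s) φ) (ones (slots s))) ⟩
      exch (slots s) (ones (slots s)) (cols j (fill dh s) (col (fill dh s) φ))
        ≡⟨ exch-ones (slots s) (cols j (fill dh s) (col (fill dh s) φ)) ⟩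
      cols j (fill dh s) (col (fill dh s) φ) (ones (slots s))
        ≡⟨ cong (λ f → f (ones (slots s))) (cols-+ j 1 (fill dh s) φ) ⟩
      cols (j ℕ.+ 1) (D ∷ H ∷ fill dh s′) φ (ones (slots s))
        -- Now all `j + 1` columns begin with the same diagonal, which is to leave occupied; it is
        -- frozen in each of them.
        ≡⟨ cols-bottom (j ℕ.+ 1) (H ∷ fill dh s′) (Φ δ m (replicate (suc r) H)) (ones (slots s)) ⟩
      cols (j ℕ.+ 1) (H ∷ fill dh s′) (Φ δ m (replicate (suc r) H)) (true ∷ ones (slots s′))
        -- Rebracketing the remaining word restores the invariant with one hole fewer and one free
        -- horizontal line more.
        ≡⟨ cong₂ (λ w → cols (j ℕ.+ 1) w (Φ δ m (replicate (suc r) H))) (dh-shift m r) (ones-shift m r) ⟩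
      cols (j ℕ.+ 1) (fill hd s″) (Φ δ m (replicate (suc r) H)) (ones (slots s″))
        ≡⟨ Φ-sixVertex δ m (suc r) (j ℕ.+ 1) ⟩
      sixVertex (m ℕ.+ (j ℕ.+ 1 ℕ.+ δ)) (m ℕ.+ suc r)
        ≡⟨ cong₂ sixVertex count (ℕₚ.+-suc m r) ⟩
      sixVertex (suc m ℕ.+ (j ℕ.+ δ)) (suc m ℕ.+ r) ∎
      where
      open ≡-Reasoning
      s  = staircase (suc m) r
      s′ = staircase m r
      s″ = staircase m (suc r)
      φ = dropTrue (Φ δ m (H ∷ replicate r H))
      word : replicate (suc m) node ++ replicate r H ≡ fill (node ∷ []) s
      word = sym (trans (fill-++ (node ∷ []) (replicate (suc m) hole) (replicate r (cell H)))
                        (cong₂ _++_ (fill-nodes (suc m)) (fill-cells (node ∷ []) r H)))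
      count : m ℕ.+ (j ℕ.+ 1 ℕ.+ δ) ≡ suc m ℕ.+ (j ℕ.+ δ)
      count = trans (cong (m ℕ.+_) (ℕₚ.+-assoc j 1 δ))
              (trans (cong (m ℕ.+_) (ℕₚ.+-suc j δ)) (ℕₚ.+-suc m (j ℕ.+ δ)))

    upper-nodes : ∀ u → vac (replicate u node) ≡ vac (upper u)
    upper-nodes u = trans (cong vac (sym (fill-nodes u))) (vac-node (replicate u hole))

    -- For DWBC1 the corner diagonal is occupied, so all `n` diagonals of the first column slide to
    -- the lower left.
    C₀-sixVertex : ∀ n → C 0 n 0 (ones (slots (staircase n 0))) ≡ sixVertex n n
    C₀-sixVertex n = begin
      C 0 n 0 (ones (slots (staircase n 0)))
        ≡⟨ C-Φ 0 (λ u bs → cong (λ f → f bs) (upper-nodes u)) n 0 _ ⟩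
      Φ 0 n [] (ones (slots (staircase n 0)))
        ≡⟨ Φ-sixVertex 0 n 0 0 ⟩
      sixVertex (n ℕ.+ 0) (n ℕ.+ 0)
        ≡⟨ cong₂ sixVertex (ℕₚ.+-identityʳ n) (ℕₚ.+-identityʳ n) ⟩
      sixVertex n n ∎
      where open ≡-Reasoning

    -- For DWBC2 the corner diagonal enters empty and counts from the start among those ending on
    -- the empty boundary: `u = 1`, `k` columns lose an occupied diagonal, and one last column loses
    -- none.
    C₁-sixVertex : ∀ k → C 1 k 1 (ones (slots (staircase k 1)) ∷ʳ false) ≡ sixVertex (suc k) (suc k)
    C₁-sixVertex k = begin
      C 1 k 1 (ones (slots (staircase k 1)) ∷ʳ false)
        ≡⟨ C-Φ 1 C-zero k 1 _ ⟩
      Φ 1 k (H ∷ D ∷ []) (ones (slots (staircase k 1)) ∷ʳ false)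
        ≡⟨ Φ-top 1 k (H ∷ []) (ones (slots (staircase k 1))) ⟩
      Φ 1 k (H ∷ []) (ones (slots (staircase k 1)))
        ≡⟨ Φ-sixVertex 1 k 1 0 ⟩
      sixVertex (k ℕ.+ 1) (k ℕ.+ 1)
        ≡⟨ cong (λ j → sixVertex j j) (ℕₚ.+-comm k 1) ⟩
      sixVertex (suc k) (suc k) ∎
      where open ≡-Reasoning

    -- Columns as transfer matrices

    column20 : (e g g′ e′ : ℕ → Bool) → ℕ → Bool → Bool → R
    column20 e g g′ e′ j v v′ = W₂₀ v (e j) (g (suc j)) (g′ j , e′ j , v′)

    column6 : (e e′ : ℕ → Bool) → ℕ → Bool → Bool → R
    column6 e e′ j v v′ = W hor v (e j) (e′ j , v′)

    topped-* : ∀ k φ p → topped (λ o → k * φ o) p ≡ k * topped φ p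
    topped-* k φ (true  , o) = refl
    topped-* k φ (false , o) = sym (zeroʳ k)

    pass-scale : ∀ w v bs k φ → pass w v bs (topped (λ o → k * φ o)) ≡ k * pass w v bs (topped φ)
    pass-scale w v bs k φ = trans (resp (lin-pass w v bs) (topped-* k φ)) (*-homo (lin-pass w v bs) k (topped φ))

    pass-matches20 : ∀ k v e g g′ e′ →
      pass (replicate (suc k) node) v (ins (suc k) e g) (topped (matches (outs (suc k) g′ e′))) ≡
      chain ∑ᴮ k (column20 e g g′ e′) v true
    pass-matches20 k v e g g′ e′ = begin
      act bools³ (W₂₀ v (e 0) (g 1)) (λ (c , b , v₁) → pass w v₁ bs
        (topped (λ o → 𝟙 (c ≡ᴮ g′ 0) * (𝟙 (b ≡ᴮ e′ 0) * matches os o))))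
        ≡⟨ resp (lin-act _ _) (λ (c , b , v₁) →
             trans (pass-scale w v₁ bs (𝟙 (c ≡ᴮ g′ 0)) _)
                   (cong (𝟙 (c ≡ᴮ g′ 0) *_) (pass-scale w v₁ bs (𝟙 (b ≡ᴮ e′ 0)) _))) ⟩
      act bools³ (W₂₀ v (e 0) (g 1)) (λ (c , b , v₁) →
        𝟙 (c ≡ᴮ g′ 0) * (𝟙 (b ≡ᴮ e′ 0) * pass w v₁ bs (topped (matches os))))
        ≡⟨ act-pick³ (W₂₀ v (e 0) (g 1)) (g′ 0) (e′ 0) (λ v₁ → pass w v₁ bs (topped (matches os))) ⟩
      ∑ᴮ (λ v₁ → column20 e g g′ e′ 0 v v₁ * pass w v₁ bs (topped (matches os)))
        ≡⟨ rest k ⟩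
      chain ∑ᴮ k (column20 e g g′ e′) v true ∎
      where
      open ≡-Reasoning
      w  = replicate k node
      bs = ins k (e ∘ suc) (g ∘ suc)
      os = outs k (g′ ∘ suc) (e′ ∘ suc)
      rest : ∀ k → ∑ᴮ (λ v₁ → column20 e g g′ e′ 0 v v₁ *
               pass (replicate k node) v₁ (ins k (e ∘ suc) (g ∘ suc)) (topped (matches (outs k (g′ ∘ suc) (e′ ∘ suc))))) ≡
             chain ∑ᴮ k (column20 e g g′ e′) v true
      rest zero    = trans (∑ᴮ-true (column20 e g g′ e′ 0 v) 1#) (*-identityʳ _)
      rest (suc k) = ∑ᴮ-cong (λ v₁ → cong (column20 e g g′ e′ 0 v v₁ *_)
                       (pass-matches20 k v₁ (e ∘ suc) (g ∘ suc) (g′ ∘ suc) (e′ ∘ suc)))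

    pass-matches6 : ∀ k v e e′ →
      pass (replicate (suc k) H) v (bits (suc k) e) (topped (matches (bits (suc k) e′))) ≡
      chain ∑ᴮ k (column6 e e′) v true
    pass-matches6 k v e e′ = begin
      act bools² (W hor v (e 0)) (λ (b , v₁) → pass w v₁ bs
        (topped (λ o → 𝟙 (b ≡ᴮ e′ 0) * matches os o)))
        ≡⟨ resp (lin-act _ _) (λ (b , v₁) → pass-scale w v₁ bs (𝟙 (b ≡ᴮ e′ 0)) _) ⟩
      act bools² (W hor v (e 0)) (λ (b , v₁) → 𝟙 (b ≡ᴮ e′ 0) * pass w v₁ bs (topped (matches os)))
        ≡⟨ act-pick² (W hor v (e 0)) (e′ 0) (λ v₁ → pass w v₁ bs (topped (matches os))) ⟩
      ∑ᴮ (λ v₁ → column6 e e′ 0 v v₁ * pass w v₁ bs (topped (matches os)))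
        ≡⟨ rest k ⟩
      chain ∑ᴮ k (column6 e e′) v true ∎
      where
      open ≡-Reasoning
      w  = replicate k H
      bs = bits k (e ∘ suc)
      os = bits k (e′ ∘ suc)
      rest : ∀ k → ∑ᴮ (λ v₁ → column6 e e′ 0 v v₁ *
               pass (replicate k H) v₁ (bits k (e ∘ suc)) (topped (matches (bits k (e′ ∘ suc))))) ≡
             chain ∑ᴮ k (column6 e e′) v true
      rest zero    = trans (∑ᴮ-true (column6 e e′ 0 v) 1#) (*-identityʳ _)
      rest (suc k) = ∑ᴮ-cong (λ v₁ → cong (column6 e e′ 0 v v₁ *_)
                       (pass-matches6 k v₁ (e ∘ suc) (e′ ∘ suc)))

    ∑ᴮ-weighted : {I : Set} {L : (I → R) → R} → Linear L → (f : Bool → R) (X : Bool → I → R) (ψ : I → R) →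
                  ∑ᴮ (λ v → f v * L (λ i → X v i * ψ i)) ≡ L (λ i → ∑ᴮ (λ v → f v * X v i) * ψ i)
    ∑ᴮ-weighted l f X ψ =
      trans (sym (∑ᴮ-comm l f (λ v i → X v i * ψ i)))
            (resp l (λ i → trans (∑ᴮ-cong (λ v → sym (*-assoc (f v) (X v i) (ψ i))))
                                 (∑ᴮ-*ʳ (λ v → f v * X v i) (ψ i))))

    -- The bridge from `pass`, which hands its outgoing edges to a function, to transfer matrices,
    -- where these edges are an index of summation.
    pass-sum6 : ∀ k v e ψ →
      pass (replicate (suc k) H) v (bits (suc k) e) (topped ψ) ≡
      ∑ (allFuns (suc k) bools) (λ a → chain ∑ᴮ k (column6 e (bit a)) v true * ψ (bits (suc k) (bit a)))
    pass-sum6 zero v e ψ = begin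
      act bools² (W hor v (e 0)) (λ (b , v₁) → if v₁ then ψ (b ∷ []) else 0#)
        ≡⟨ act-∑² (W hor v (e 0)) (λ (b , v₁) → if v₁ then ψ (b ∷ []) else 0#) ⟩
      ∑ᴮ (λ b → ∑ᴮ (λ v₁ → W hor v (e 0) (b , v₁) * (if v₁ then ψ (b ∷ []) else 0#)))
        ≡⟨ ∑ᴮ-cong (λ b → trans (∑ᴮ-true (λ v₁ → W hor v (e 0) (b , v₁)) (ψ (b ∷ []))) (sym (+-identityʳ _))) ⟩
      ∑ᴮ (λ b → ∑ (allFuns 0 bools) (λ f → W hor v (e 0) (b , true) * ψ (b ∷ [])))
        ≡⟨ sym (∑ᴮ-allFuns 0 (λ b f → W hor v (e 0) (b , true) * ψ (b ∷ []))) ⟩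
      ∑ (allFuns 1 bools) (λ a → chain ∑ᴮ 0 (column6 e (bit a)) v true * ψ (bits 1 (bit a))) ∎
      where open ≡-Reasoning
    pass-sum6 (suc k) v e ψ = begin
      act bools² (W hor v (e 0)) (λ (b , v₁) →
        pass (replicate (suc k) H) v₁ (bits (suc k) (e ∘ suc)) (topped (ψ ∘ (b ∷_))))
        ≡⟨ act-∑² (W hor v (e 0)) _ ⟩
      ∑ᴮ (λ b → ∑ᴮ (λ v₁ → W hor v (e 0) (b , v₁) *
        pass (replicate (suc k) H) v₁ (bits (suc k) (e ∘ suc)) (topped (ψ ∘ (b ∷_)))))
        ≡⟨ ∑ᴮ-cong (λ b → ∑ᴮ-cong (λ v₁ → cong (W hor v (e 0) (b , v₁) *_)
             (pass-sum6 k v₁ (e ∘ suc) (ψ ∘ (b ∷_))))) ⟩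
      ∑ᴮ (λ b → ∑ᴮ (λ v₁ → W hor v (e 0) (b , v₁) * ∑ (allFuns (suc k) bools) (λ a →
        chain ∑ᴮ k (column6 (e ∘ suc) (bit a)) v₁ true * ψ (b ∷ bits (suc k) (bit a)))))
        ≡⟨ ∑ᴮ-cong (λ b → ∑ᴮ-weighted (lin-∑ (allFuns (suc k) bools)) (λ v₁ → W hor v (e 0) (b , v₁))
             (λ v₁ a → chain ∑ᴮ k (column6 (e ∘ suc) (bit a)) v₁ true) (λ a → ψ (b ∷ bits (suc k) (bit a)))) ⟩
      ∑ᴮ (λ b → ∑ (allFuns (suc k) bools) (h b))
        ≡⟨ sym (∑ᴮ-allFuns (suc k) h) ⟩
      ∑ (allFuns (suc (suc k)) bools) (λ a →
        chain ∑ᴮ (suc k) (column6 e (bit a)) v true * ψ (bits (suc (suc k)) (bit a))) ∎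
      where
      open ≡-Reasoning
      h = λ b a → ∑ᴮ (λ v₁ → W hor v (e 0) (b , v₁) * chain ∑ᴮ k (column6 (e ∘ suc) (bit a)) v₁ true) *
                  ψ (b ∷ bits (suc k) (bit a))

    ∑ᴮ-allFuns² : (k : ℕ) (h : Bool → (Fin k → Bool) → Bool → (Fin k → Bool) → R) →
      ∑ (allFuns (suc k) bools) (λ c → ∑ (allFuns (suc k) bools) (λ a → h (c zero) (c ∘ suc) (a zero) (a ∘ suc))) ≡
      ∑ᴮ (λ x → ∑ᴮ (λ y → ∑ (allFuns k bools) (λ c → ∑ (allFuns k bools) (h x c y))))
    ∑ᴮ-allFuns² k h = begin
      _ ≡⟨ ∑ᴮ-allFuns k (λ x c → ∑ (allFuns (suc k) bools) (λ a → h x c (a zero) (a ∘ suc))) ⟩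
      ∑ᴮ (λ x → ∑ (allFuns k bools) (λ c → ∑ (allFuns (suc k) bools) (λ a → h x c (a zero) (a ∘ suc))))
        ≡⟨ ∑ᴮ-cong (λ x → trans (∑-cong (allFuns k bools) (λ c → trans (∑ᴮ-allFuns k (h x c)) (∑ᴮ≡∑ _)))
             (trans (∑-swap (allFuns k bools) bools (λ c y → ∑ (allFuns k bools) (h x c y))) (sym (∑ᴮ≡∑ _)))) ⟩
      ∑ᴮ (λ x → ∑ᴮ (λ y → ∑ (allFuns k bools) (λ c → ∑ (allFuns k bools) (h x c y)))) ∎
      where open ≡-Reasoning

    pass-sum20 : ∀ k v e g ψ →
      pass (replicate (suc k) node) v (ins (suc k) e g) (topped ψ) ≡
      ∑ (allFuns (suc k) bools) (λ c → ∑ (allFuns (suc k) bools) (λ a →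
        chain ∑ᴮ k (column20 e g (bit c) (bit a)) v true * ψ (outs (suc k) (bit c) (bit a))))
    pass-sum20 zero v e g ψ = begin
      act bools³ (W₂₀ v (e 0) (g 1)) (λ (c , b , v₁) → if v₁ then ψ (c ∷ b ∷ []) else 0#)
        ≡⟨ trans (act-∑³ _ _) (∑ᴮ-cong (λ c → act-∑² _ _)) ⟩
      ∑ᴮ (λ c → ∑ᴮ (λ b → ∑ᴮ (λ v₁ → W₂₀ v (e 0) (g 1) (c , b , v₁) * (if v₁ then ψ (c ∷ b ∷ []) else 0#))))
        ≡⟨ ∑ᴮ-cong (λ c → ∑ᴮ-cong (λ b →
             trans (∑ᴮ-true (λ v₁ → W₂₀ v (e 0) (g 1) (c , b , v₁)) (ψ (c ∷ b ∷ [])))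
                   (sym (trans (+-identityʳ _) (+-identityʳ _))))) ⟩
      ∑ᴮ (λ c → ∑ᴮ (λ b → ∑ (allFuns 0 bools) (λ _ → ∑ (allFuns 0 bools) (λ _ → h c b))))
        ≡⟨ sym (∑ᴮ-allFuns² 0 (λ c _ b _ → h c b)) ⟩
      ∑ (allFuns 1 bools) (λ c → ∑ (allFuns 1 bools) (λ a →
        chain ∑ᴮ 0 (column20 e g (bit c) (bit a)) v true * ψ (outs 1 (bit c) (bit a)))) ∎
      where
      open ≡-Reasoning
      h = λ c b → W₂₀ v (e 0) (g 1) (c , b , true) * ψ (c ∷ b ∷ [])
    pass-sum20 (suc k) v e g ψ = begin
      act bools³ (W₂₀ v (e 0) (g 1)) (λ (c , b , v₁) →
        pass (replicate (suc k) node) v₁ (ins (suc k) (e ∘ suc) (g ∘ suc)) (topped (λ o → ψ (c ∷ b ∷ o))))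
        ≡⟨ trans (act-∑³ _ _) (∑ᴮ-cong (λ c → act-∑² _ _)) ⟩
      ∑ᴮ (λ c → ∑ᴮ (λ b → ∑ᴮ (λ v₁ → W₂₀ v (e 0) (g 1) (c , b , v₁) *
        pass (replicate (suc k) node) v₁ (ins (suc k) (e ∘ suc) (g ∘ suc)) (topped (λ o → ψ (c ∷ b ∷ o))))))
        ≡⟨ ∑ᴮ-cong (λ c → ∑ᴮ-cong (λ b → trans
             (∑ᴮ-cong (λ v₁ → cong (W₂₀ v (e 0) (g 1) (c , b , v₁) *_)
               (pass-sum20 k v₁ (e ∘ suc) (g ∘ suc) (λ o → ψ (c ∷ b ∷ o)))))
             (∑ᴮ-weighted linear (λ v₁ → W₂₀ v (e 0) (g 1) (c , b , v₁))
               (λ v₁ (c′ , a) → chain ∑ᴮ k (column20 (e ∘ suc) (g ∘ suc) (bit c′) (bit a)) v₁ true)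
               (λ (c′ , a) → ψ (c ∷ b ∷ outs (suc k) (bit c′) (bit a)))))) ⟩
      ∑ᴮ (λ c → ∑ᴮ (λ b → ∑ (allFuns (suc k) bools) (λ c′ → ∑ (allFuns (suc k) bools) (h c c′ b))))
        ≡⟨ sym (∑ᴮ-allFuns² (suc k) h) ⟩
      ∑ (allFuns (suc (suc k)) bools) (λ c → ∑ (allFuns (suc (suc k)) bools) (λ a →
        chain ∑ᴮ (suc k) (column20 e g (bit c) (bit a)) v true * ψ (outs (suc (suc k)) (bit c) (bit a)))) ∎
      where
      open ≡-Reasoning
      fs = allFuns (suc k) bools
      linear : Linear {(Fin (suc k) → Bool) × (Fin (suc k) → Bool)} (λ φ → ∑ fs (λ c → ∑ fs (λ a → φ (c , a))))
      linear = lin-bind (lin-∑ fs) (λ c → lin-∘ (lin-∑ fs) (c ,_))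
      h : Bool → (Fin (suc k) → Bool) → Bool → (Fin (suc k) → Bool) → R
      h c c′ b a = ∑ᴮ (λ v₁ → W₂₀ v (e 0) (g 1) (c , b , v₁) *
                     chain ∑ᴮ k (column20 (e ∘ suc) (g ∘ suc) (bit c′) (bit a)) v₁ true) *
                   ψ (c ∷ b ∷ outs (suc k) (bit c′) (bit a))

    vac-bits : ∀ n o → vac (replicate n H) o ≡ matches (bits n (const false)) o
    vac-bits zero    []          = refl
    vac-bits zero    (_ ∷ _)     = refl
    vac-bits (suc n) []          = refl
    vac-bits (suc n) (true ∷ o)  = sym (zeroˡ _)
    vac-bits (suc n) (false ∷ o) = trans (vac-bits n o) (sym (*-identityˡ _))

    vac-outs : ∀ n o → vac (replicate n node) o ≡ matches (outs n (const false) (const false)) o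
    vac-outs zero    []                  = refl
    vac-outs zero    (_ ∷ _)             = refl
    vac-outs (suc n) []                  = refl
    vac-outs (suc n) (true ∷ o)          = sym (zeroˡ _)
    vac-outs (suc n) (false ∷ [])        = sym (zeroʳ _)
    vac-outs (suc n) (false ∷ true ∷ o)  = sym (trans (*-identityˡ _) (zeroˡ _))
    vac-outs (suc n) (false ∷ false ∷ o) =
      trans (vac-outs n o) (sym (trans (*-identityˡ _) (*-identityˡ _)))

    -- The empty diagonal that `C` adds on top after the last column of DWBC1 has no counterpart in
    -- the grid; it completes the list to the two edges per node that `vac` expects.
    vac-outs-top : ∀ n o → vac (replicate (suc n) node) (o ∷ʳ false) ≡
                   matches (false ∷ outs n (const false) (const false)) o
    vac-outs-top n       []                      = refl
    vac-outs-top n       (true ∷ o)              = sym (zeroˡ _)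
    vac-outs-top zero    (false ∷ [])            = sym (*-identityˡ _)
    vac-outs-top zero    (false ∷ true ∷ o)      = sym (zeroʳ _)
    vac-outs-top zero    (false ∷ false ∷ [])    = sym (zeroʳ _)
    vac-outs-top zero    (false ∷ false ∷ _ ∷ o) = sym (zeroʳ _)
    vac-outs-top (suc n) (false ∷ [])            = sym (zeroʳ _)
    vac-outs-top (suc n) (false ∷ true ∷ o)      = sym (trans (*-identityˡ _) (zeroˡ _))
    vac-outs-top (suc n) (false ∷ false ∷ o)     =
      trans (vac-outs-top n o) (sym (trans (*-identityˡ _) (*-identityˡ _)))

    S₆ : ℕ → ((ℕ → Bool) → R) → R
    S₆ k φ = ∑ (allFuns (suc k) bools) (φ ∘ bit)

    U₆ : ℕ → (e e′ : ℕ → Bool) → R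
    U₆ k e e′ = chain ∑ᴮ k (column6 e e′) false true

    chain-sixVertex : ∀ k m e → chain (S₆ k) m (λ _ → U₆ k) e (const false) ≡
                      cols (suc m) (replicate (suc k) H) (vac (replicate (suc k) H)) (bits (suc k) e)
    chain-sixVertex k zero    e =
      sym (trans (col-cong (replicate (suc k) H) (vac-bits (suc k)) (bits (suc k) e))
                 (pass-matches6 k false e (const false)))
    chain-sixVertex k (suc m) e =
      trans (∑-cong (allFuns (suc k) bools) (λ a → cong (U₆ k e (bit a) *_) (chain-sixVertex k m (bit a))))
            (sym (pass-sum6 k false e (cols (suc m) (replicate (suc k) H) (vac (replicate (suc k) H)))))

    -- Between two columns all horizontal edges are free, while the lowest diagonal is the occupied
    -- South boundary edge and the topmost one the empty North boundary edge.
    S₂₀ : ℕ → ((ℕ → Bool) × (ℕ → Bool) → R) → R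
    S₂₀ k φ = ∑ (allFuns (suc k) bools) (λ a → ∑ (allFuns k bools) (λ c → φ (bit a , cons true c)))

    U₂₀ : ℕ → (p p′ : (ℕ → Bool) × (ℕ → Bool)) → R
    U₂₀ k (e , g) (e′ , g′) = chain ∑ᴮ k (column20 e g g′ e′) false true

    -- The same columns, with their number of nodes fixed to suc k and all boundary
    -- edges of the last one prescribed.
    G : Bool → ℕ → ℕ → List Bool → R
    G c k zero    = col (replicate (suc k) node) (matches (outs (suc k) (rightDia c) (const false)))
    G c k (suc m) = col (replicate (suc k) node) (dropTrue (λ o → G c k m (o ∷ʳ false)))

    -- Gluing of neighbouring columns: the outgoing list without its lowest diagonal and with an
    -- empty one on top is the ingoing list of the next column. Terms with an empty lowest diagonal
    -- are killed by `dropTrue`.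
    col-sum : ∀ k e g (φ : List Bool → R) → col (replicate (suc k) node) (dropTrue (λ o → φ (o ∷ʳ false))) (ins (suc k) e g) ≡
              S₂₀ k (λ p → U₂₀ k (e , g) p * φ (ins (suc k) (proj₁ p) (proj₂ p)))
    col-sum k e g φ = begin
      col (replicate (suc k) node) ψ (ins (suc k) e g)
        ≡⟨ pass-sum20 k false e g ψ ⟩
      ∑ fs (λ c → ∑ fs (λ a → U₂₀ k (e , g) (bit a , bit c) * ψ (outs (suc k) (bit c) (bit a))))
        ≡⟨ ∑-cong fs (λ c → ∑-cong fs (λ a → cong₂ _*_
             (chain-cong lin-∑ᴮ k (λ j v v′ → cong (λ b → W₂₀ v (e j) (g (suc j)) (b , bit a j , v′)) (bit-cons c j)) false true)
             (cong ψ (outs-cong (suc k) (bit a) (bit-cons c))))) ⟩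
      ∑ fs (λ c → h (c zero) (c ∘ suc))
        ≡⟨ trans (∑ᴮ-allFuns k h) (∑ᴮ≡∑ _) ⟩
      ∑ (allFuns k bools) (h true) + (∑ (allFuns k bools) (h false) + 0#)
        ≡⟨ cong (∑ (allFuns k bools) (h true) +_) (trans (+-identityʳ _) bottom-empty) ⟩
      ∑ (allFuns k bools) (h true) + 0#
        ≡⟨ +-identityʳ _ ⟩
      ∑ (allFuns k bools) (h true)
        ≡⟨ ∑-cong (allFuns k bools) (λ c → ∑-cong fs (λ a → cong (λ o → U₂₀ k (e , g) (bit a , cons true c) * φ o) (boundary c a))) ⟩
      ∑ (allFuns k bools) (λ c → ∑ fs (λ a →
        U₂₀ k (e , g) (bit a , cons true c) * φ (ins (suc k) (bit a) (cons true c))))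
        ≡⟨ ∑-swap (allFuns k bools) fs _ ⟩
      S₂₀ k (λ p → U₂₀ k (e , g) p * φ (ins (suc k) (proj₁ p) (proj₂ p))) ∎
      where
      open ≡-Reasoning
      fs = allFuns (suc k) bools
      ψ  = dropTrue (λ o → φ (o ∷ʳ false))
      h : Bool → (Fin k → Bool) → R
      h b c = ∑ fs (λ a → U₂₀ k (e , g) (bit a , cons b c) * ψ (outs (suc k) (cons b c) (bit a)))
      bottom-empty : ∑ (allFuns k bools) (h false) ≡ 0#
      bottom-empty = 0-homo (lin-∑ (allFuns k bools)) _ (λ c → 0-homo (lin-∑ fs) _ (λ a → zeroʳ _))
      boundary : ∀ (c : Fin k → Bool) (a : Fin (suc k) → Bool) →
                 bit a 0 ∷ outs k (bit c) (bit a ∘ suc) ∷ʳ false ≡ ins (suc k) (bit a) (cons true c)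
      boundary c a = trans (cong (λ b → bit a 0 ∷ outs k (bit c) (bit a ∘ suc) ∷ʳ b) (sym (at-end c false)))
                           (outs-ins k (bit a) (cons true c))

    chain-G : ∀ c k m e g → chain (S₂₀ k) m (λ _ → U₂₀ k) (e , g) (const false , rightDia c) ≡
              G c k m (ins (suc k) e g)
    chain-G c k zero    e g = sym (pass-matches20 k false e g (rightDia c) (const false))
    chain-G c k (suc m) e g =
      trans (∑-cong (allFuns (suc k) bools) (λ a → ∑-cong (allFuns k bools) (λ d →
               cong (U₂₀ k (e , g) (bit a , cons true d) *_) (chain-G c k m (bit a) (cons true d)))))
            (sym (col-sum k e g (G c k m)))

    C₁-G : ∀ k m u → m ℕ.+ u ≡ suc k → ∀ bs → C 1 m u bs ≡ G false k m bs
    C₁-G k zero    u refl bs = col-cong (replicate (suc k) node) (vac-outs (suc k)) bs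
    C₁-G k (suc m) u eq   bs =
      trans (cong (λ n → col (replicate n node) (dropTrue (λ o → C 1 m (suc u) (o ∷ʳ false))) bs) eq)
            (col-cong (replicate (suc k) node)
              (dropTrue-cong (λ o → C₁-G k m (suc u) (trans (ℕₚ.+-suc m u) eq) (o ∷ʳ false))) bs)

    -- With `δ = 0` the last column is among the `suc m` columns of `C`, because its lowest
    -- diagonal, the corner edge, leaves occupied like the others. For `G` it is the base case,
    -- hence the shifted index.
    C₀-G : ∀ k m u → suc m ℕ.+ u ≡ suc k → ∀ bs → C 0 (suc m) u bs ≡ G true k m bs
    C₀-G k zero    u refl bs = col-cong (replicate (suc k) node) last bs
      where
      last : ∀ o → dropTrue (λ o → vac (replicate (suc k) node) (o ∷ʳ false)) o ≡
             matches (outs (suc k) (rightDia true) (const false)) o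
      last []          = refl
      last (true ∷ o)  = trans (vac-outs-top k o) (sym (*-identityˡ _))
      last (false ∷ o) = sym (zeroˡ _)
    C₀-G k (suc m) u eq   bs =
      trans (cong (λ n → col (replicate n node) (dropTrue (λ o → C 0 (suc m) (suc u) (o ∷ʳ false))) bs) eq)
            (col-cong (replicate (suc k) node)
              (dropTrue-cong (λ o → C₀-G k m (suc u) (trans (cong suc (ℕₚ.+-suc m u)) eq) (o ∷ʳ false))) bs)

    chain₂₀≡chain₆ : ∀ bc k → chain (S₂₀ k) k (λ _ → U₂₀ k)
                   (const true , leftDia (corner bc) (suc k)) (const false , rightDia (corner bc)) ≡
                 chain (S₆ k) k (λ _ → U₆ k) (const true) (const false)
    chain₂₀≡chain₆ bc k = trans (chain-G (corner bc) k k (const true) (leftDia (corner bc) (suc k)))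
                     (trans (value bc)
                     (sym (trans (chain-sixVertex k k (const true))
                                 (cong (cols (suc k) (replicate (suc k) H) (vac (replicate (suc k) H))) (bits-true (suc k))))))
      where
      value : ∀ bc → G (corner bc) k k (ins (suc k) (const true) (leftDia (corner bc) (suc k))) ≡
              sixVertex (suc k) (suc k)
      value DWBC1 = trans (cong (G true k k) (ins-left-DWBC1 k))
                    (trans (sym (C₀-G k k 0 (ℕₚ.+-identityʳ (suc k)) _)) (C₀-sixVertex (suc k)))
      value DWBC2 = trans (cong (G false k k) (ins-left-DWBC2 k))
                    (trans (sym (C₁-G k k 1 (ℕₚ.+-comm k 1) _)) (C₁-sixVertex k))

    -- Configurations as products of vertex weights

    -- The double negations come from `isTypeB`, where a vertical edge is occupied if it points
    -- south.
    record Vertices (r : R) : Set where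
      field
        W₂₀-indeg : ∀ v b c c′ b′ v′ → W₂₀ v b c (c′ , b′ , v′) ≡
          𝟙 (ind b ℕ.+ ind (not b′) ℕ.+ ind v ℕ.+ ind (not v′) ℕ.+ ind (not c′) ℕ.+ ind c ≡ᵇ 3)
        hor-indeg : ∀ v b b′ v′ → W hor v b (b′ , v′) ≡
          𝟙 (ind b ℕ.+ ind (not b′) ℕ.+ ind v ℕ.+ ind (not v′) ≡ᵇ 2) *
          (if (b ∧ b′ ∧ not (not v) ∧ not (not v′)) ∨ (not v ∧ not v′ ∧ not b ∧ not b′) then r else 1#)

    module _ (r : R) (weighting : Vertices r) where
      open Vertices weighting

      ∑-config20 : ∀ bc k → # numConfigs20 bc (suc k) ≡
        chain (S₂₀ k) k (λ _ → U₂₀ k)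
          (const true , leftDia (corner bc) (suc k)) (const false , rightDia (corner bc))
      ∑-config20 bc k = begin
        # numConfigs20 bc n
          ≡⟨ #-length (isConfig20 bc n) (allOrientations20 n) ⟩
        ∑ (allOrientations20 n) (λ c → 𝟙 (isConfig20 bc n c))
          ≡⟨ ∑-concatMap _ (allArrays k n) _ ⟩
        ∑ (allArrays k n) (λ h → ∑ (concatMap (λ v → map (λ d → cfg20 h v d) (allArrays k k)) (allArrays n k))
          (λ c → 𝟙 (isConfig20 bc n c)))
          -- Once the horizontal and diagonal edges are fixed, the vertical edges of different
          -- columns are independent. Summing over them innermost lets the sum factor over the
          -- columns.
          ≡⟨ ∑-cong (allArrays k n) (λ h → trans (∑-concatMap-map (cfg20 h) (allArrays n k) (allArrays k k) _)
                                                (∑-swap (allArrays n k) (allArrays k k) _)) ⟩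
        ∑ (allArrays k n) (λ h → ∑ (allArrays k k) (λ d → ∑ (allArrays n k) (λ v → 𝟙 (isConfig20 bc n (cfg20 h v d)))))
          ≡⟨ ∑-cong (allArrays k n) (λ h → ∑-cong (allArrays k k) (λ d → trans
               (∑-cong (allArrays n k) (λ v → local h v d))
               (trans (∏-∑ n (allFuns k bools) (const false) (column h d))
                      (∏-cong n (λ i _ → column-∑ k (column20 (E h i) (D′ d i) (D′ d (suc i)) (E h (suc i)))))))) ⟩
        ∑ (allArrays k n) (λ h → ∑ (allArrays k k) (λ d → ∏ n (λ i →
          U₂₀ k (E h i , D′ d i) (E h (suc i) , D′ d (suc i)))))
          ≡⟨ chain-allFuns² bit (cons true) (allFuns n bools) (allFuns k bools) k (λ _ → U₂₀ k)
               (const true) (leftDia (corner bc) n) (const false) (rightDia (corner bc)) ⟩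
        chain (S₂₀ k) k (λ _ → U₂₀ k)
          (const true , leftDia (corner bc) n) (const false , rightDia (corner bc)) ∎
        where
        open ≡-Reasoning
        n = suc k
        E : HorOr n → ℕ → ℕ → Bool
        E h = fence (const true) (bit ∘ h) (const false)
        D′ : DiaOr n → ℕ → ℕ → Bool
        D′ d = fence (leftDia (corner bc) n) (cons true ∘ d) (rightDia (corner bc))
        column : HorOr n → DiaOr n → ℕ → (Fin k → Bool) → R
        column h d i v = ∏ n (λ j →
          column20 (E h i) (D′ d i) (D′ d (suc i)) (E h (suc i)) j (fence false v true j) (fence false v true (suc j)))
        local : ∀ h v d → 𝟙 (isConfig20 bc n (cfg20 h v d)) ≡ ∏ n (λ i → column h d i (at v i (const false)))
        local h v d = trans (𝟙-allᵇ _ (vertices n)) (trans (∏ₗ-vertices n _)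
          (∏-cong n (λ i i<n → ∏-cong n (λ j j<n → vertex i j i<n j<n))))
          where
          vertex : ∀ i j → i < n → j < n → 𝟙 (indeg20 bc n (cfg20 h v d) (suc i) (suc j) ≡ᵇ 3) ≡
            column20 (E h i) (D′ d i) (D′ d (suc i)) (E h (suc i)) j
              (fence false (at v i (const false)) true j) (fence false (at v i (const false)) true (suc j))
          vertex i j i<n j<n
            rewrite sym (east-fence k h i j (ℕₚ.<⇒≤ i<n)) | sym (east-fence k h (suc i) j i<n)
                  | sym (north-fence k v i j (ℕₚ.<⇒≤ j<n)) | sym (north-fence k v i (suc j) j<n)
                  | sym (se-fence bc k d i (suc j) (ℕₚ.<⇒≤ i<n) j<n) | sym (se-fence bc k d (suc i) j i<n (ℕₚ.<⇒≤ j<n))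
            = sym (W₂₀-indeg (north n v (suc i) j) (east n h i (suc j)) (se bc n d i (suc j))
                             (se bc n d (suc i) j) (east n h (suc i) (suc j)) (north n v (suc i) (suc j)))

      ∑-config6 : ∀ k → ∑ (configs6 (suc k)) (λ c → r ^ numB (suc k) c) ≡
        chain (S₆ k) k (λ _ → U₆ k) (const true) (const false)
      ∑-config6 k = begin
        ∑ (configs6 n) (λ c → r ^ numB n c)
          ≡⟨ ∑-filterᵇ (isConfig6 n) (allOrientations6 n) _ ⟩
        ∑ (allOrientations6 n) (λ c → 𝟙 (isConfig6 n c) * r ^ numB n c)
          ≡⟨ ∑-concatMap-map cfg6 (allArrays k n) (allArrays n k) _ ⟩
        ∑ (allArrays k n) (λ h → ∑ (allArrays n k) (λ v → 𝟙 (isConfig6 n (cfg6 h v)) * r ^ numB n (cfg6 h v)))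
          ≡⟨ ∑-cong (allArrays k n) (λ h → trans (∑-cong (allArrays n k) (local h))
               (trans (∏-∑ n (allFuns k bools) (const false) (column h))
                      (∏-cong n (λ i _ → column-∑ k (column6 (E h i) (E h (suc i))))))) ⟩
        ∑ (allArrays k n) (λ h → ∏ n (λ i → U₆ k (E h i) (E h (suc i))))
          ≡⟨ chain-allFuns bit (allFuns n bools) k (λ _ → U₆ k) (const true) (const false) ⟩
        chain (S₆ k) k (λ _ → U₆ k) (const true) (const false) ∎
        where
        open ≡-Reasoning
        n = suc k
        E : HorOr n → ℕ → ℕ → Bool
        E h = fence (const true) (bit ∘ h) (const false)
        column : HorOr n → ℕ → (Fin k → Bool) → R
        column h i v = ∏ n (λ j →
          column6 (E h i) (E h (suc i)) j (fence false v true j) (fence false v true (suc j)))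
        local : ∀ h v → 𝟙 (isConfig6 n (cfg6 h v)) * r ^ numB n (cfg6 h v) ≡
                ∏ n (λ i → column h i (at v i (const false)))
        local h v = trans (cong₂ _*_ (𝟙-allᵇ _ (vertices n)) (^-length r (λ (x , y) → isTypeB n (cfg6 h v) x y) (vertices n)))
          (trans (∏ₗ-* (vertices n) _ _) (trans (∏ₗ-vertices n _)
          (∏-cong n (λ i i<n → ∏-cong n (λ j j<n → vertex i j i<n j<n)))))
          where
          vertex : ∀ i j → i < n → j < n →
            𝟙 (indeg6 n (cfg6 h v) (suc i) (suc j) ≡ᵇ 2) * (if isTypeB n (cfg6 h v) (suc i) (suc j) then r else 1#) ≡
            column6 (E h i) (E h (suc i)) j
              (fence false (at v i (const false)) true j) (fence false (at v i (const false)) true (suc j))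
          vertex i j i<n j<n
            rewrite sym (east-fence k h i j (ℕₚ.<⇒≤ i<n)) | sym (east-fence k h (suc i) j i<n)
                  | sym (north-fence k v i j (ℕₚ.<⇒≤ j<n)) | sym (north-fence k v i (suc j) j<n)
            = sym (hor-indeg (north n v (suc i) j) (east n h i (suc j))
                             (east n h (suc i) (suc j)) (north n v (suc i) (suc j)))

      numConfigs20-sum : ∀ bc k → # numConfigs20 bc (suc k) ≡ ∑ (configs6 (suc k)) (λ c → r ^ numB (suc k) c)
      numConfigs20-sum bc k = trans (∑-config20 bc k) (trans (chain₂₀≡chain₆ bc k) (sym (∑-config6 k)))

-- The commutative semiring of numbers p + q √2 with rational p and q

-- (p , q) stands for p + q √2.
ℚ√2 : Set
ℚ√2 = ℚ × ℚ

infixl 6 _+ᴿ_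
infixl 7 _*ᴿ_
_+ᴿ_ _*ᴿ_ : ℚ√2 → ℚ√2 → ℚ√2
(a , b) +ᴿ (c , d) = a ℚ.+ c , b ℚ.+ d
(a , b) *ᴿ (c , d) = a ℚ.* c ℚ.+ (b ℚ.* d ℚ.+ b ℚ.* d) , a ℚ.* d ℚ.+ b ℚ.* c

0# 1# √2 1/√2 : ℚ√2
0# = 0ℚ , 0ℚ
1# = 1ℚ , 0ℚ
√2 = 0ℚ , 1ℚ
1/√2 = 0ℚ , ½

open +-*-Solver

isCommutativeSemiring : IsCommutativeSemiring _≡_ _+ᴿ_ _*ᴿ_ 0# 1#
isCommutativeSemiring = record
  { isSemiring = record
    { isSemiringWithoutAnnihilatingZero = record
      { +-isCommutativeMonoid = record
        { isMonoid = record
          { isSemigroup = record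
            { isMagma = record { isEquivalence = isEquivalence ; ∙-cong = cong₂ _+ᴿ_ }
            ; assoc = λ (a , b) (c , d) (e , f) → cong₂ _,_ (ℚₚ.+-assoc a c e) (ℚₚ.+-assoc b d f)
            }
          ; identity = (λ (a , b) → cong₂ _,_ (ℚₚ.+-identityˡ a) (ℚₚ.+-identityˡ b))
                     , (λ (a , b) → cong₂ _,_ (ℚₚ.+-identityʳ a) (ℚₚ.+-identityʳ b))
          }
        ; comm = λ (a , b) (c , d) → cong₂ _,_ (ℚₚ.+-comm a c) (ℚₚ.+-comm b d)
        }
      ; *-cong = cong₂ _*ᴿ_
      ; *-assoc = λ (a , b) (c , d) (e , f) → cong₂ _,_
          (solve 6 (λ a b c d e f →
             (a :* c :+ (b :* d :+ b :* d)) :* e :+ ((a :* d :+ b :* c) :* f :+ (a :* d :+ b :* c) :* f) :=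
             a :* (c :* e :+ (d :* f :+ d :* f)) :+ (b :* (c :* f :+ d :* e) :+ b :* (c :* f :+ d :* e)))
             refl a b c d e f)
          (solve 6 (λ a b c d e f →
             (a :* c :+ (b :* d :+ b :* d)) :* f :+ (a :* d :+ b :* c) :* e :=
             a :* (c :* f :+ d :* e) :+ b :* (c :* e :+ (d :* f :+ d :* f)))
             refl a b c d e f)
      ; *-identity = (λ x → trans (comm 1# x) (identity x)) , identity
      ; distrib = distribˡ , (λ x y z → trans (comm (y +ᴿ z) x) (trans (distribˡ x y z)
                                          (cong₂ _+ᴿ_ (comm x y) (comm x z))))
      }
    ; zero = zeroˡ , (λ x → trans (comm x 0#) (zeroˡ x))
    }
  ; *-comm = comm
  }
  where
  comm : ∀ x y → x *ᴿ y ≡ y *ᴿ x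
  comm (a , b) (c , d) = cong₂ _,_
    (solve 4 (λ a b c d → a :* c :+ (b :* d :+ b :* d) := c :* a :+ (d :* b :+ d :* b)) refl a b c d)
    (solve 4 (λ a b c d → a :* d :+ b :* c := c :* b :+ d :* a) refl a b c d)
  identity : ∀ x → x *ᴿ 1# ≡ x
  identity (a , b) = cong₂ _,_
    (solve 2 (λ a b → a :* con 1ℚ :+ (b :* con 0ℚ :+ b :* con 0ℚ) := a) refl a b)
    (solve 2 (λ a b → a :* con 0ℚ :+ b :* con 1ℚ := b) refl a b)
  zeroˡ : ∀ x → 0# *ᴿ x ≡ 0#
  zeroˡ (a , b) = cong₂ _,_
    (solve 2 (λ a b → con 0ℚ :* a :+ (con 0ℚ :* b :+ con 0ℚ :* b) := con 0ℚ) refl a b)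
    (solve 2 (λ a b → con 0ℚ :* b :+ con 0ℚ :* a := con 0ℚ) refl a b)
  distribˡ : ∀ x y z → x *ᴿ (y +ᴿ z) ≡ x *ᴿ y +ᴿ x *ᴿ z
  distribˡ (a , b) (c , d) (e , f) = cong₂ _,_
    (solve 6 (λ a b c d e f →
       a :* (c :+ e) :+ (b :* (d :+ f) :+ b :* (d :+ f)) :=
       (a :* c :+ (b :* d :+ b :* d)) :+ (a :* e :+ (b :* f :+ b :* f))) refl a b c d e f)
    (solve 6 (λ a b c d e f →
       a :* (d :+ f) :+ b :* (c :+ e) := (a :* d :+ b :* c) :+ (a :* f :+ b :* e)) refl a b c d e f)

_≟_ : DecidableEquality ℚ√2
_≟_ = ≡-dec ℚₚ._≟_ ℚₚ._≟_

∀ᴮ? : {P : Bool → Set} → (∀ b → Dec (P b)) → Dec (∀ b → P b)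
∀ᴮ? P? = map′ (λ (t , f) → λ { true → t ; false → f }) (λ p → p true , p false) (P? true ×-dec P? false)

module Sem = Semiring _+ᴿ_ _*ᴿ_ 0# 1# isCommutativeSemiring
open Sem hiding (+-assoc; +-comm; *-assoc; *-comm; distribˡ)
open Sem.Linear

-- Verification of the weights

conserved : Bool → Bool → Bool → Bool → Bool
conserved v b b′ v′ = ind b ℕ.+ ind (not b′) ℕ.+ ind v ℕ.+ ind (not v′) ≡ᵇ 2

-- The types count vertical edges as occupied when they point south, the conservation law when they
-- point north. In the latter convention type b means that all or none of the four edges are
-- occupied.
typeB : Bool → Bool → Bool → Bool → Bool
typeB v b b′ v′ = (b ∧ b′ ∧ not (not v) ∧ not (not v′)) ∨ (not v ∧ not v′ ∧ not b ∧ not b′)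

-- Dividing the weights of the diagonal crossings by √2 makes the frozen ones 1.
W : Line → Kernel
W hor v b (b′ , v′) = if conserved v b b′ v′ then (if typeB v b b′ v′ then √2 else 1#) else 0#
W dia v c (c′ , v′) =
  if conserved v c c′ v′ then (if not (v ≡ᴮ c) ∧ (c ≡ᴮ c′) then 1# else 1/√2) else 0#

W× : Kernel
W× b c (c′ , b′) = if conserved b c c′ b′ then (if b ≡ᴮ c then 1# else 1/√2) else 0#

W₂₀ : Kernel³
W₂₀ v b c (c′ , b′ , v′) =
  𝟙 (ind b ℕ.+ ind (not b′) ℕ.+ ind v ℕ.+ ind (not v′) ℕ.+ ind (not c′) ℕ.+ ind c ≡ᵇ 3)

-- Restricting to conserving outcomes keeps the closed checks below small.
sparse : Bool → Bool → Kernel → (Bool × Bool → ℚ√2) → ℚ√2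
sparse a b k φ = ∑ (filterᵇ (λ (b′ , a′) → conserved a b b′ a′) bools²) (λ x → k a b x *ᴿ φ x)

if-vanish : ∀ p {x : ℚ√2} → p ≡ false → (if p then x else 0#) ≡ 0#
if-vanish false refl = refl

act-sparse : ∀ a b (k : Kernel) φ → (∀ x → conserved a b (proj₁ x) (proj₂ x) ≡ false → k a b x ≡ 0#) →
             act bools² (k a b) φ ≡ sparse a b k φ
act-sparse a b k φ off = act-filterᵇ (λ (b′ , a′) → conserved a b b′ a′) bools² φ off

act-W : ∀ ℓ v b φ → act bools² (W ℓ v b) φ ≡ sparse v b (W ℓ) φ
act-W hor v b φ = act-sparse v b (W hor) φ (λ (b′ , v′) → if-vanish (conserved v b b′ v′))
act-W dia v b φ = act-sparse v b (W dia) φ (λ (b′ , v′) → if-vanish (conserved v b b′ v′))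

act-W× : ∀ b c φ → act bools² (W× b c) φ ≡ sparse b c W× φ
act-W× b c φ = act-sparse b c W× φ (λ (c′ , b′) → if-vanish (conserved b c c′ b′))

diaFirst-sparse horFirst-sparse : Bool → Bool → Bool → (Bool × Bool × Bool → ℚ√2) → ℚ√2
diaFirst-sparse v b c φ =
  sparse b c W× λ (c₁ , b₁) → sparse v c₁ (W dia) λ (c₂ , v₁) →
  sparse v₁ b₁ (W hor) λ (b₂ , v₂) → φ (c₂ , b₂ , v₂)
horFirst-sparse v b c φ =
  sparse v b (W hor) λ (b₁ , v₁) → sparse v₁ c (W dia) λ (c₁ , v₂) →
  sparse b₁ c₁ W× λ (c₂ , b₂) → φ (c₂ , b₂ , v₂)

diaFirst≡ : ∀ v b c φ → diaFirst W W× v b c φ ≡ diaFirst-sparse v b c φ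
diaFirst≡ v b c φ =
  trans (resp (lin-act _ _) λ (c₁ , b₁) → trans (resp (lin-act _ _) λ (c₂ , v₁) → act-W hor v₁ b₁ _) (act-W dia v c₁ _))
        (act-W× b c _)

horFirst≡ : ∀ v b c φ → horFirst W W× v b c φ ≡ horFirst-sparse v b c φ
horFirst≡ v b c φ =
  trans (resp (lin-act _ _) λ (b₁ , v₁) → trans (resp (lin-act _ _) λ (c₁ , v₂) → act-W× b₁ c₁ _) (act-W dia v₁ c _))
        (act-W hor v b _)

opaque
  unfolding bools²

  -- One closed equation for each of the 64 states of the six edges at a node, decided by
  -- evaluation.
  diaFirst-check : ∀ v b c c′ b′ v′ →
    diaFirst-sparse v b c (λ i → 𝟙 ((c′ , b′ , v′) ≡³ i)) ≡ W₂₀ v b c (c′ , b′ , v′)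
  diaFirst-check = toWitness {a? = ∀ᴮ? λ v → ∀ᴮ? λ b → ∀ᴮ? λ c → ∀ᴮ? λ c′ → ∀ᴮ? λ b′ → ∀ᴮ? λ v′ →
    diaFirst-sparse v b c (λ i → 𝟙 ((c′ , b′ , v′) ≡³ i)) ≟ W₂₀ v b c (c′ , b′ , v′)} tt

  horFirst-check : ∀ v b c c′ b′ v′ →
    horFirst-sparse v b c (λ i → 𝟙 ((c′ , b′ , v′) ≡³ i)) ≡ W₂₀ v b c (c′ , b′ , v′)
  horFirst-check = toWitness {a? = ∀ᴮ? λ v → ∀ᴮ? λ b → ∀ᴮ? λ c → ∀ᴮ? λ c′ → ∀ᴮ? λ b′ → ∀ᴮ? λ v′ →
    horFirst-sparse v b c (λ i → 𝟙 ((c′ , b′ , v′) ≡³ i)) ≟ W₂₀ v b c (c′ , b′ , v′)} tt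

weights : Weights
weights = record
  { W = W ; W× = W× ; W₂₀ = W₂₀
  ; diaFirst-δ = λ v b c x → trans (diaFirst≡ v b c _) (diaFirst-check v b c _ _ _)
  ; horFirst-δ = λ v b c x → trans (horFirst≡ v b c _) (horFirst-check v b c _ _ _)
  ; ×-full     = λ { (true , true) → refl ; (true , false) → refl ; (false , true) → refl ; (false , false) → refl }
  ; ×-empty    = λ { true true → refl ; true false → refl ; false true → refl ; false false → refl }
  ; dia-top    = λ { true true → refl ; true false → refl ; false true → refl ; false false → refl }
  ; dia-bottom = λ { true true → refl ; true false → refl ; false true → refl ; false false → refl }
  }

if-𝟙 : ∀ p x → (if p then x else 0#) ≡ 𝟙 p *ᴿ x
if-𝟙 true  x = sym (Sem.*-identityˡ x)
if-𝟙 false x = sym (Sem.zeroˡ x)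

indegrees : Sem.Transfer.Vertices weights √2
indegrees = record
  { W₂₀-indeg = λ v b c c′ b′ v′ → refl
  ; hor-indeg = λ v b b′ v′ → if-𝟙 (conserved v b b′ v′) _
  }

-- Descent to natural coefficients

num : ℕ → ℚ
num zero    = 0ℚ
num (suc k) = 1ℚ ℚ.+ num k

num-+ : ∀ m n → num (m ℕ.+ n) ≡ num m ℚ.+ num n
num-+ zero    n = sym (ℚₚ.+-identityˡ (num n))
num-+ (suc m) n = trans (cong (1ℚ ℚ.+_) (num-+ m n)) (sym (ℚₚ.+-assoc 1ℚ (num m) (num n)))

num-nonneg : ∀ k → 0ℚ ℚ.≤ num k
num-nonneg zero    = ℚₚ.≤-refl
num-nonneg (suc k) = ℚₚ.+-mono-≤ (toWitness {a? = 0ℚ ℚₚ.≤? 1ℚ} tt) (num-nonneg k)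

num-suc≢0 : ∀ k → ¬ 0ℚ ≡ num (suc k)
num-suc≢0 k eq = ℚₚ.<-irrefl eq (ℚₚ.+-mono-<-≤ (toWitness {a? = 0ℚ ℚₚ.<? 1ℚ} tt) (num-nonneg k))

num-injective : ∀ m n → num m ≡ num n → m ≡ n
num-injective zero    zero    eq = refl
num-injective zero    (suc n) eq = ⊥-elim (num-suc≢0 n eq)
num-injective (suc m) zero    eq = ⊥-elim (num-suc≢0 m (sym eq))
num-injective (suc m) (suc n) eq =
  cong suc (num-injective m n (∙-cancelˡ ℚₚ.+-0-group 1ℚ (num m) (num n) eq))

ι : ℕ√2 → ℚ√2
ι (p + q √2) = num p , num q

-- The crossings need the weight 1/√2, which has no counterpart in `ℕ√2`. The identity is therefore
-- proved in `ℚ√2` and pulled back along this embedding.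
ι-injective : ∀ x y → ι x ≡ ι y → x ≡ y
ι-injective (p + q √2) (p′ + q′ √2) eq =
  cong₂ _+_√2 (num-injective p p′ (cong proj₁ eq)) (num-injective q q′ (cong proj₂ eq))

ι-⊕ : ∀ x y → ι (x ⊕ y) ≡ ι x +ᴿ ι y
ι-⊕ (p + q √2) (p′ + q′ √2) = cong₂ _,_ (num-+ p p′) (num-+ q q′)

ι-fromℕ : ∀ k → ι (fromℕ k) ≡ # k
ι-fromℕ zero    = refl
ι-fromℕ (suc k) = cong (1# +ᴿ_) (ι-fromℕ k)

ι-times√2 : ∀ x → ι (times√2 x) ≡ √2 *ᴿ ι x
ι-times√2 (p + q √2) = cong₂ _,_
  (trans (trans (num-+ q (q ℕ.+ 0)) (cong (λ t → num q ℚ.+ num t) (ℕₚ.+-identityʳ q)))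
         (solve 2 (λ p q → q :+ q := con 0ℚ :* p :+ (con 1ℚ :* q :+ con 1ℚ :* q)) refl (num p) (num q)))
  (solve 2 (λ p q → p := con 0ℚ :* q :+ con 1ℚ :* p) refl (num p) (num q))

ι-√2^ : ∀ k → ι (√2^ k) ≡ √2 ^ k
ι-√2^ zero    = refl
ι-√2^ (suc k) = trans (ι-times√2 (√2^ k)) (cong (√2 *ᴿ_) (ι-√2^ k))

ι-Z6V : ∀ n → ι (Z6V n) ≡ ∑ (configs6 n) (λ c → √2 ^ numB n c)
ι-Z6V n = go (configs6 n)
  where
  go : ∀ cs → ι (foldr (λ c acc → √2^ (numB n c) ⊕ acc) (0 + 0 √2) cs) ≡ ∑ cs (λ c → √2 ^ numB n c)
  go []       = refl
  go (c ∷ cs) = trans (ι-⊕ (√2^ (numB n c)) _) (cong₂ _+ᴿ_ (ι-√2^ (numB n c)) (go cs))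

fromℕ-numConfigs20 : ∀ bc n → 1 ≤ n → fromℕ (numConfigs20 bc n) ≡ Z6V n
fromℕ-numConfigs20 bc (suc k) _ = ι-injective _ _ (begin
  ι (fromℕ (numConfigs20 bc (suc k)))             ≡⟨ ι-fromℕ (numConfigs20 bc (suc k)) ⟩
  # numConfigs20 bc (suc k)                       ≡⟨ Sem.Transfer.numConfigs20-sum weights √2 indegrees bc k ⟩
  ∑ (configs6 (suc k)) (λ c → √2 ^ numB (suc k) c) ≡⟨ sym (ι-Z6V (suc k)) ⟩
  ι (Z6V (suc k))                                 ∎)
  where open ≡-Reasoning

theorem3p1 : (n : ℕ) → 1 ≤ n →
    (fromℕ (numConfigs20 DWBC1 n) ≡ Z6V n) × (fromℕ (numConfigs20 DWBC2 n) ≡ Z6V n)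
theorem3p1 n 1≤n = fromℕ-numConfigs20 DWBC1 n 1≤n , fromℕ-numConfigs20 DWBC2 n 1≤n
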